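{- For every $\epsilon>0$ there is an algorithm that, given a finite, simple, unweighted, undirected, connected graph $G$ on $n$ vertices, a set $S\subseteq V(G)$ with $|S|=k$ such that $G-S$ is a forest, and an integer $\ell$ such that $G$ has a shortest path $P^*$ with $d_G(v,P^*)\le\ell$ for all $v\in V(G)$, outputs a shortest path $P$ in $G$ with $d_G(v,P)\le(1+\epsilon)\ell$ for all $v\in V(G)$, and runs in time $\mathcal{O}(2^{\mathcal{O}(k\log k)}\, n^{\mathcal{O}(1)})$.
   Context: $d_G$ denotes graph distance and $d_G(v,P)=\min_{w\in V(P)}d_G(v,w)$. A shortest path is a path whose length equals the distance in $G$ between its endpoints. The maximum of $d_G(v,P)$ over $v\in V(G)$ is the eccentricity of $P$. -}

module Defs where

open import Data.Bool using (Bool; true; false; T)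
open import Data.Fin using (Fin; zero; suc; toℕ)
open import Data.Fin.Subset using (Subset; ∁; _∈_)
open import Data.Integer using (ℤ; +_; -[1+_])
open import Data.List using (List; []; _∷_; map; allFin)
import Data.List.Membership.Propositional as List
open import Data.List.Relation.Unary.Unique.Propositional using (Unique)
open import Data.Nat using (ℕ; zero; suc; _+_; _≤_)
open import Data.Product using (Σ; ∃; _×_; proj₁; proj₂)
open import Data.Rational using (ℚ; _/_) renaming (_≤_ to _≤ℚ_)
open import Data.Vec using (Vec; []; _∷_; lookup; toList)
open import Level using (0ℓ)
open import Relation.Binary.Construct.Closure.ReflexiveTransitive using (Star; ε; _◅_)
open import Relation.Binary.Core using (Rel)
open import Relation.Binary.Definitions using (Symmetric; Irreflexive)
open import Relation.Binary.PropositionalEquality using (_≡_; cong)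
open import Relation.Nullary using (¬_)

record Graph (V : Set) : Set where
  field
    adj? : V → V → Bool

  Adj : Rel V 0ℓ
  Adj u v = T (adj? u v)

  field
    sym    : Symmetric Adj
    irrefl : Irreflexive _≡_ Adj

open Graph public using (adj?; Adj)

_-ᵍ_ : ∀ {n} → Graph (Fin n) → (S : Subset n) → Graph (Σ (Fin n) (_∈ ∁ S))
G -ᵍ S = record
  { adj?   = λ u v → adj? G (proj₁ u) (proj₁ v)
  ; sym    = Graph.sym G
  ; irrefl = λ u≡v → Graph.irrefl G (cong proj₁ u≡v)
  }

Walk : ∀ {V} → Graph V → V → V → Set
Walk G = Star (Adj G)

module _ {V : Set} {E : Rel V 0ℓ} where

  vertices : ∀ {u v} → Star E u v → List V
  vertices {u} ε       = u ∷ []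
  vertices {u} (_ ◅ w) = u ∷ vertices w

  -- The number of edges.
  length : ∀ {u v} → Star E u v → ℕ
  length ε       = 0
  length (_ ◅ w) = suc (length w)

record Path {V : Set} (G : Graph V) (u v : V) : Set where
  field
    walk   : Walk G u v
    simple : Unique (vertices walk)

open Path public using (walk)

record Cycle {V : Set} (G : Graph V) : Set where
  field
    {u v}   : V
    path    : Path G u v
    long    : 2 ≤ length (walk path)
    closing : Adj G v u

Forest : ∀ {V} → Graph V → Set
Forest G = ¬ Cycle G

Connected : ∀ {V} → Graph V → Set
Connected G = ∀ u v → Path G u v

IsMinimum : (ℕ → Set) → ℕ → Set
IsMinimum A m = A m × (∀ i → A i → m ≤ i)

-- Distances are given as functional relations: Dist G u v d means
-- d_G(u,v) = d, and DistTo G v ws d means that d is the minimum of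
-- d_G(v,w) over the vertices w in ws.
Dist : ∀ {V} → Graph V → V → V → ℕ → Set
Dist G u v = IsMinimum λ d → Σ (Path G u v) λ p → length (walk p) ≡ d

DistTo : ∀ {V} → Graph V → V → List V → ℕ → Set
DistTo G v ws = IsMinimum λ d → ∃ λ w → w List.∈ ws × Dist G v w d

record ShortestPath {V : Set} (G : Graph V) : Set where
  field
    {source target} : V
    path            : Path G source target
    shortest        : Dist G source target (length (walk path))

  pathVertices : List V
  pathVertices = vertices (walk path)

open ShortestPath public using (pathVertices)

EccentricityAtMost : ∀ {V} (G : Graph V) → ShortestPath G → ℚ → Set
EccentricityAtMost G P r =
  ∀ v → ∃ λ d → DistTo G v (pathVertices P) d × (+ d / 1) ≤ℚ r

-- The machine model: the call-by-value λ-calculus with recursive functions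
-- over binary trees (pure Lisp), evaluated with environments and closures.
-- The cost of an evaluation is the number of rule instances in its
-- derivation.  As values are shared, a rule instance takes a random access
-- machine a constant amount of work for a fixed program, so cost agrees with
-- the time of standard machine models up to a polynomial.  Programs are
-- uniform: they are closed terms that receive their input in the environment.
-- Arithmetic is not primitive; numbers are unary trees, which a program
-- inspects one successor at a time.

data Term (m : ℕ) : Set where
  var   : Fin m → Term m
  leaf  : Term m
  node  : Term m → Term m → Term m
  -- match t on leaf ↦ l | node x y ↦ r, with x bound as 0 and y as 1 in r.
  match : (t l : Term m) (r : Term (2 + m)) → Term m
  -- In the body, 0 is the argument and 1 the function itself.
  fun   : Term (2 + m) → Term m
  app   : Term m → Term m → Term m
  bind  : Term m → Term (1 + m) → Term m

data Value : Set where
  leaf    : Value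
  node    : Value → Value → Value
  closure : ∀ {m} → Vec Value m → Term (2 + m) → Value

Env : ℕ → Set
Env = Vec Value

infix 4 _⊢_⇓_[_]

data _⊢_⇓_[_] {m : ℕ} (ρ : Env m) : Term m → Value → ℕ → Set where
  var : ∀ {i} → ρ ⊢ var i ⇓ lookup ρ i [ 1 ]

  leaf : ρ ⊢ leaf ⇓ leaf [ 1 ]

  node : ∀ {t u x y c d} →
    ρ ⊢ t ⇓ x [ c ] → ρ ⊢ u ⇓ y [ d ] →
    ρ ⊢ node t u ⇓ node x y [ suc (c + d) ]

  match-leaf : ∀ {t l r z c d} →
    ρ ⊢ t ⇓ leaf [ c ] → ρ ⊢ l ⇓ z [ d ] →
    ρ ⊢ match t l r ⇓ z [ suc (c + d) ]

  match-node : ∀ {t l r x y z c d} →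
    ρ ⊢ t ⇓ node x y [ c ] → x ∷ y ∷ ρ ⊢ r ⇓ z [ d ] →
    ρ ⊢ match t l r ⇓ z [ suc (c + d) ]

  fun : ∀ {b} → ρ ⊢ fun b ⇓ closure ρ b [ 1 ]

  app : ∀ {t u k x z c d e} {ρ′ : Env k} {b} →
    ρ ⊢ t ⇓ closure ρ′ b [ c ] → ρ ⊢ u ⇓ x [ d ] →
    x ∷ closure ρ′ b ∷ ρ′ ⊢ b ⇓ z [ e ] →
    ρ ⊢ app t u ⇓ z [ suc (c + d + e) ]

  bind : ∀ {t u x z c d} →
    ρ ⊢ t ⇓ x [ c ] → x ∷ ρ ⊢ u ⇓ z [ d ] →
    ρ ⊢ bind t u ⇓ z [ suc (c + d) ]

encodeBool : Bool → Value
encodeBool false = leaf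
encodeBool true  = node leaf leaf

encodeℕ : ℕ → Value
encodeℕ zero    = leaf
encodeℕ (suc n) = node leaf (encodeℕ n)

encodeℤ : ℤ → Value
encodeℤ (+ n)    = node (encodeBool false) (encodeℕ n)
encodeℤ -[1+ n ] = node (encodeBool true) (encodeℕ n)

encodeList : ∀ {A : Set} → (A → Value) → List A → Value
encodeList f []       = leaf
encodeList f (x ∷ xs) = node (f x) (encodeList f xs)

-- The adjacency matrix.
encodeGraph : ∀ {n} → Graph (Fin n) → Value
encodeGraph {n} G =
  encodeList (λ u → encodeList (λ v → encodeBool (adj? G u v)) (allFin n)) (allFin n)

-- The characteristic vector.
encodeSubset : ∀ {n} → Subset n → Value
encodeSubset S = encodeList encodeBool (toList S)

encodePath : ∀ {n} {G : Graph (Fin n)} → ShortestPath G → Value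
encodePath P = encodeList (λ v → encodeℕ (toℕ v)) (pathVertices P)

input : ∀ {n} → Graph (Fin n) → Subset n → ℤ → Env 3
input G S ℓ = encodeGraph G ∷ encodeSubset S ∷ encodeℤ ℓ ∷ []

{-# OPTIONS --safe #-}
module Submission where

open import Defs
open import Data.Bool using (Bool; true; false; T)
open import Data.Fin using (Fin; zero; suc; toℕ; fromℕ<)
open import Data.Fin.Properties using (injective⇒≤; toℕ-injective; toℕ<n; toℕ-fromℕ<)
open import Data.Fin.Subset using (Subset; ∣_∣)
open import Data.Integer using (ℤ; -[1+_])
import Data.Integer as ℤ
import Data.Integer.Properties as ℤ
open import Data.List as List using (List; []; _∷_; _++_; allFin; applyUpTo; foldr; map; replicate; tabulate)
open import Data.List.Extrema.Nat using (argmin; argmin-sel; f[argmin]≤f[xs]; f[argmin]≤f[⊤])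
open import Data.List.Membership.Propositional using () renaming (_∈_ to _∈ₗ_)
open import Data.List.Membership.Propositional.Properties
  using (∈-++⁺ˡ; ∈-++⁺ʳ; ∈-++⁻; ∈-allFin; ∈-applyUpTo⁺; ∈-applyUpTo⁻; ∈-lookup; ∈-map⁻)
open import Data.List.Properties
  using (length-++; length-applyUpTo; length-map; length-replicate; length-tabulate; map-tabulate)
open import Data.List.Relation.Unary.All as All using (All; []; _∷_)
open import Data.List.Relation.Unary.AllPairs using ([]; _∷_)
open import Data.List.Relation.Unary.Any using (here; there)
open import Data.List.Relation.Unary.Unique.Propositional using (Unique)
open import Data.Nat using (ℕ; zero; suc; pred; _+_; _*_; _∸_; _^_; _⊔_; _⊓_; _≤_; _<_; _≤?_; _<?_; z≤n; s≤s; NonZero)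
open import Data.Nat.Divisibility using (divides-refl)
open import Data.Nat.DivMod
  using (_%_; m≡m%n+[m/n]*n; m%n<n; 0/n≡0; m/n≤m; m/n*n≤m; /-monoˡ-≤; +-distrib-/-∣ʳ; m<n⇒m/n≡0; m*n/n≡m; m<n*o⇒m/o<n)
  renaming (_/_ to _÷_)
open import Data.Nat.Logarithm using (⌈log₂_⌉)
open import Data.Nat.Properties hiding (_≤?_; _<?_)
open import Data.Nat.Solver using (module +-*-Solver)
open import Data.Product using (Σ; ∃; _×_; _,_; proj₁; proj₂)
open import Data.Rational using (ℚ; 0ℚ; 1ℚ; _/_) renaming (_<_ to _<ℚ_; _≤_ to _≤ℚ_; _+_ to _+ℚ_; _*_ to _*ℚ_)
open import Data.Rational as ℚ using (mkℚ; toℚᵘ)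
import Data.Rational.Properties as ℚ
open import Data.Rational.Unnormalised as ℚᵘ using (mkℚᵘ; *≤*)
import Data.Rational.Unnormalised.Properties as ℚᵘ
open import Data.Sum as Sum using (_⊎_; inj₁; inj₂; [_,_]′)
open import Data.Unit using (⊤; tt)
open import Data.Vec using ([]; _∷_; lookup)
open import Function using (_⇔_; mk⇔; Equivalence; _∘_; id)
open import Relation.Binary.Construct.Closure.ReflexiveTransitive using (ε; _◅_; _◅◅_)
open import Relation.Binary.PropositionalEquality
open import Relation.Nullary using (contradiction; yes; no)

open Equivalence using (to; from)

-- Let q be the denominator of ε, h = ⌊ℓ / q⌋ and r = ℓ + h ≤ (1 + ε) ℓ, and let
-- s be the source of P*.  If the landmarks are the vertices of P* whose distance
-- from s is a multiple of 1 + h, then every vertex is within r of a landmark.  A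
-- landmark within r of v has a distance from s that differs from d(s,v) by at
-- most r, which leaves no more than 2 q + 2 consecutive landmarks.  So a search
-- for a path from s may forget all but the last 2 q + 2 landmarks: its states are
-- pairs (c , W) of the path's endpoint and a list W of 2 q + 2 of its vertices,
-- of which there are polynomially many for fixed q.  On leaving (c , W) the
-- vertices v with d(s,v) + r = d(s,c) must be within r of W, at the end all v with
-- d(s,v) + r ≥ d(s,c) must be, and each step increases d(s,c).  Hence every
-- successful search yields a shortest path of eccentricity at most r.  Trying all
-- sources and increasing r, the first success has r ≤ ℓ + ⌊ℓ / q⌋.
--
-- A program is built from combinators on records that hold a λ-term, its
-- denotation, and polynomial bounds on its time and on the size of its result.

-- Polynomial-time programs

-- Searching along a path, one would expect to have to remember which vertices are already covered,
-- and there are exponentially many such sets. Here each vertex v is tested at a single moment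
-- determined by d(s,v), so nothing about v is stored: past level d(s,v) + r no vertex of a shortest
-- path from s is within r of v, and since the level d(s,c) rises by exactly one per step, it cannot
-- jump over this moment. Landmarks matter only for completeness, where they show that a short W
-- passes every test along P*. For soundness it is enough that W consists of vertices of the path
-- walked so far, because a vertex within r of W is then within r of the path. The rounding in h
-- serves both ends: h is at most ℓ / q, which keeps r small, while the spacing 1 + h exceeds ℓ / q,
-- which keeps the landmarks sparse. The obstacle in the cost analysis is that a fold whose step has
-- a polynomial size bound may still build an exponentially large result. Every loop therefore needs
-- its own bound on the accumulator; most lemmas about `width` provide one.

infixl 6 _⊕_
infixl 7 _⊗_
infix 8 _⟨_⟩

-- Syntax rather than functions, so that `poly-bounded` can read off an exponent by recursion.
-- Composition is a constructor because `split`, `case` and `fold` feed the size of one program into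
-- the bounds of the next.
data Poly : Set where
  con         : ℕ → Poly
  X           : Poly
  _⊕_ _⊗_ _⟨_⟩ : Poly → Poly → Poly

⟦_⟧ₚ : Poly → ℕ → ℕ
⟦ con k ⟧ₚ   N = k
⟦ X ⟧ₚ       N = N
⟦ p ⊕ q ⟧ₚ   N = ⟦ p ⟧ₚ N + ⟦ q ⟧ₚ N
⟦ p ⊗ q ⟧ₚ   N = ⟦ p ⟧ₚ N * ⟦ q ⟧ₚ N
⟦ p ⟨ q ⟩ ⟧ₚ N = ⟦ p ⟧ₚ (⟦ q ⟧ₚ N)

infixr 2 _×ₜ_

data Ty : Set where
  unit vtx : Ty
  list     : Ty → Ty
  _×ₜ_     : Ty → Ty → Ty

-- Numbers are unary lists and truth values are lists, the empty one being
-- false; both have the encodings prescribed for ℕ and Bool.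
nat : Ty
nat = list unit

⟦_⟧ : Ty → ℕ → Set
⟦ unit ⟧    n = ⊤
⟦ vtx ⟧     n = Fin n
⟦ list τ ⟧  n = List (⟦ τ ⟧ n)
⟦ σ ×ₜ τ ⟧  n = ⟦ σ ⟧ n × ⟦ τ ⟧ n

private variable
  n m N : ℕ
  σ τ υ : Ty
  Γ     : List Ty
  A     : Set

enc : ∀ τ → ⟦ τ ⟧ n → Value
enc unit     _       = leaf
enc vtx      v       = encodeℕ (toℕ v)
enc (list τ) xs      = encodeList (enc τ) xs
enc (σ ×ₜ τ) (x , y) = node (enc σ x) (enc τ y)

-- For a list this is max (i + width xᵢ): it bounds the length and all
-- entries, and consing increases it by at most one.
width : ∀ τ → ⟦ τ ⟧ n → ℕ
width unit     _        = 0
width vtx      v        = toℕ v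
width (list τ) []       = 0
width (list τ) (x ∷ xs) = width τ x ⊔ suc (width (list τ) xs)
width (σ ×ₜ τ) (x , y)  = width σ x ⊔ width τ y

Vals : ℕ → List Ty → Set
Vals n = All (λ τ → ⟦ τ ⟧ n)

Renaming : List Ty → ℕ → Set
Renaming Γ m = ∀ σ → σ ∈ₗ Γ → Fin m

Bounded : ℕ → Vals n Γ → Set
Bounded {Γ = Γ} N γ = ∀ σ (x : σ ∈ₗ Γ) → width σ (All.lookup γ x) ≤ N

Represents : Env m → Renaming Γ m → Vals n Γ → Set
Represents {Γ = Γ} ρ r γ = ∀ σ (x : σ ∈ₗ Γ) → lookup ρ (r σ x) ≡ enc σ (All.lookup γ x)

infix 4 _⊢_⇓_within_

_⊢_⇓_within_ : Env m → Term m → Value → ℕ → Set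
ρ ⊢ t ⇓ v within C = ∃ λ c → ρ ⊢ t ⇓ v [ c ] × c ≤ C

-- The code exists for every placement r of Γ in an environment, which makes
-- substitution and renaming of terms unnecessary.
record Prog (Γ : List Ty) (τ : Ty) : Set where
  no-eta-equality
  field
    eval      : Vals n Γ → ⟦ τ ⟧ n
    code      : Renaming Γ m → Term m
    time size : Poly
    runs      : ∀ (γ : Vals n Γ) (r : Renaming Γ m) (ρ : Env m) →
                Bounded N γ → Represents ρ r γ →
                ρ ⊢ code r ⇓ enc τ (eval γ) within ⟦ time ⟧ₚ N
    sized     : ∀ (γ : Vals n Γ) → Bounded N γ → width τ (eval γ) ≤ ⟦ size ⟧ₚ N

open Prog public

infixr 5 _∷ᵇ_

_∷ᵇ_ : {x : ⟦ σ ⟧ n} {γ : Vals n Γ} →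
       width σ x ≤ N → Bounded N γ → Bounded N (x ∷ γ)
(p ∷ᵇ b) _ (here refl) = p
(p ∷ᵇ b) _ (there i)   = b _ i

Bounded-mono : ∀ {M} (γ : Vals n Γ) → N ≤ M → Bounded N γ → Bounded M γ
Bounded-mono γ N≤M b σ x = ≤-trans (b σ x) N≤M

var# : σ ∈ₗ Γ → Prog Γ σ
var# x .eval γ          = All.lookup γ x
var# x .code r          = var (r _ x)
var# x .time            = con 1
var# x .size            = X
var# x .runs γ r ρ b ρ≈ = 1 , subst (λ v → ρ ⊢ var (r _ x) ⇓ v [ 1 ]) (ρ≈ _ x) var , ≤-refl
var# x .sized γ b       = b _ x

wk : Prog Γ τ → Prog (σ ∷ Γ) τ
wk p .eval (_ ∷ γ)          = eval p γ
wk p .code r                = code p λ σ x → r σ (there x)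
wk p .time                  = time p
wk p .size                  = size p
wk p .runs (_ ∷ γ) r ρ b ρ≈ =
  runs p γ (λ σ x → r σ (there x)) ρ (λ σ x → b σ (there x)) (λ σ x → ρ≈ σ (there x))
wk p .sized (_ ∷ γ) b       = sized p γ λ σ x → b σ (there x)

wk² : ∀ {σ₁ σ₂} → Prog Γ τ → Prog (σ₁ ∷ σ₂ ∷ Γ) τ
wk² p = wk (wk p)

wk³ : ∀ {σ₁ σ₂ σ₃} → Prog Γ τ → Prog (σ₁ ∷ σ₂ ∷ σ₃ ∷ Γ) τ
wk³ p = wk (wk² p)

wk⁴ : ∀ {σ₁ σ₂ σ₃ σ₄} → Prog Γ τ → Prog (σ₁ ∷ σ₂ ∷ σ₃ ∷ σ₄ ∷ Γ) τ
wk⁴ p = wk² (wk² p)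

wk⁵ : ∀ {σ₁ σ₂ σ₃ σ₄ σ₅} → Prog Γ τ → Prog (σ₁ ∷ σ₂ ∷ σ₃ ∷ σ₄ ∷ σ₅ ∷ Γ) τ
wk⁵ p = wk² (wk³ p)

#0 : Prog (σ ∷ Γ) σ
#0 = var# (here refl)

#1 : ∀ {σ₀} → Prog (σ₀ ∷ σ ∷ Γ) σ
#1 = var# (there (here refl))

#2 : ∀ {σ₀ σ₁} → Prog (σ₀ ∷ σ₁ ∷ σ ∷ Γ) σ
#2 = var# (there (there (here refl)))

#3 : ∀ {σ₀ σ₁ σ₂} → Prog (σ₀ ∷ σ₁ ∷ σ₂ ∷ σ ∷ Γ) σ
#3 = var# (there (there (there (here refl))))

#4 : ∀ {σ₀ σ₁ σ₂ σ₃} → Prog (σ₀ ∷ σ₁ ∷ σ₂ ∷ σ₃ ∷ σ ∷ Γ) σ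
#4 = var# (there (there (there (there (here refl)))))

star : Prog Γ unit
star .eval _         = tt
star .code _         = leaf
star .time           = con 1
star .size           = con 0
star .runs _ _ _ _ _ = 1 , leaf , ≤-refl
star .sized _ _      = z≤n

nil : Prog Γ (list τ)
nil .eval _         = []
nil .code _         = leaf
nil .time           = con 1
nil .size           = con 0
nil .runs _ _ _ _ _ = 1 , leaf , ≤-refl
nil .sized _ _      = z≤n

cons : Prog Γ τ → Prog Γ (list τ) → Prog Γ (list τ)
cons p q .eval γ = eval p γ ∷ eval q γ
cons p q .code r = node (code p r) (code q r)
cons p q .time   = con 1 ⊕ (time p ⊕ time q)
cons p q .size   = size p ⊕ (con 1 ⊕ size q)
cons p q .runs γ r ρ b ρ≈ =
  let _ , dp , cp = runs p γ r ρ b ρ≈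
      _ , dq , cq = runs q γ r ρ b ρ≈
  in _ , node dp dq , s≤s (+-mono-≤ cp cq)
cons p q .sized γ b = ⊔-lub
  (≤-trans (sized p γ b) (m≤m+n _ _))
  (≤-trans (s≤s (sized q γ b)) (m≤n+m _ _))

pair : Prog Γ σ → Prog Γ τ → Prog Γ (σ ×ₜ τ)
pair p q .eval γ = eval p γ , eval q γ
pair p q .code r = node (code p r) (code q r)
pair p q .time   = con 1 ⊕ (time p ⊕ time q)
pair p q .size   = size p ⊕ size q
pair p q .runs γ r ρ b ρ≈ =
  let _ , dp , cp = runs p γ r ρ b ρ≈
      _ , dq , cq = runs q γ r ρ b ρ≈
  in _ , node dp dq , s≤s (+-mono-≤ cp cq)
pair p q .sized γ b = ⊔-lub
  (≤-trans (sized p γ b) (m≤m+n _ _))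
  (≤-trans (sized q γ b) (m≤n+m _ _))

private
  under₂ : Renaming Γ m → Renaming (σ ∷ τ ∷ Γ) (2 + m)
  under₂ r _ (here _)          = zero
  under₂ r _ (there (here _))  = suc zero
  under₂ r _ (there (there x)) = suc (suc (r _ x))

  under₂-represents : {γ : Vals n Γ} {r : Renaming Γ m} {ρ : Env m} →
    (x : ⟦ σ ⟧ n) (y : ⟦ τ ⟧ n) → Represents ρ r γ →
    Represents (enc σ x ∷ enc τ y ∷ ρ) (under₂ r) (x ∷ y ∷ γ)
  under₂-represents x y ρ≈ _ (here refl)         = refl
  under₂-represents x y ρ≈ _ (there (here refl)) = refl
  under₂-represents x y ρ≈ _ (there (there i))   = ρ≈ _ i

-- Values are untyped, so match needs a leaf branch, which is never taken.
split : Prog Γ (σ ×ₜ τ) → Prog (σ ∷ τ ∷ Γ) υ → Prog Γ υ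
split p q .eval γ = let x , y = eval p γ in eval q (x ∷ y ∷ γ)
split p q .code r = match (code p r) leaf (code q (under₂ r))
split p q .time   = con 1 ⊕ (time p ⊕ time q ⟨ X ⊕ size p ⟩)
split p q .size   = size q ⟨ X ⊕ size p ⟩
split p q .runs {N = N} γ r ρ b ρ≈ =
  let _ , dp , cp = runs p γ r ρ b ρ≈
      x , y       = eval p γ
      p≤          = ≤-trans (sized p γ b) (m≤n+m _ N)
      _ , dq , cq = runs q (x ∷ y ∷ γ) (under₂ r) _
        (≤-trans (m≤m⊔n _ _) p≤ ∷ᵇ ≤-trans (m≤n⊔m _ _) p≤ ∷ᵇ Bounded-mono γ (m≤m+n _ _) b)
        (under₂-represents x y ρ≈)
  in _ , match-node dp dq , s≤s (+-mono-≤ cp cq)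
split p q .sized {N = N} γ b =
  let p≤ = ≤-trans (sized p γ b) (m≤n+m _ N)
  in sized q _ (≤-trans (m≤m⊔n _ _) p≤ ∷ᵇ ≤-trans (m≤n⊔m _ _) p≤ ∷ᵇ Bounded-mono γ (m≤m+n _ _) b)

caseList : {A B : Set} → List A → B → (A → List A → B) → B
caseList []       b f = b
caseList (x ∷ xs) b f = f x xs

case : Prog Γ (list σ) → Prog Γ τ → Prog (σ ∷ list σ ∷ Γ) τ → Prog Γ τ
case p q s .eval γ = caseList (eval p γ) (eval q γ) λ x xs → eval s (x ∷ xs ∷ γ)
case p q s .code r = match (code p r) (code q r) (code s (under₂ r))
-- Sums over the two branches stand in for a maximum, which `Poly` lacks.
case p q s .time   = con 1 ⊕ (time p ⊕ (time q ⊕ time s ⟨ X ⊕ size p ⟩))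
case p q s .size   = size q ⊕ size s ⟨ X ⊕ size p ⟩
case p q s .runs {N = N} γ r ρ b ρ≈
  with eval p γ | runs p γ r ρ b ρ≈ | ≤-trans (sized p γ b) (m≤n+m (⟦ size p ⟧ₚ N) N)
... | []     | _ , dp , cp | _  =
  let _ , dq , cq = runs q γ r ρ b ρ≈
  in _ , match-leaf dp dq , s≤s (+-mono-≤ cp (≤-trans cq (m≤m+n _ _)))
... | x ∷ xs | _ , dp , cp | p≤ =
  let _ , ds , cs = runs s (x ∷ xs ∷ γ) (under₂ r) _
        (≤-trans (m≤m⊔n _ _) p≤ ∷ᵇ ≤-trans (≤-trans (n≤1+n _) (m≤n⊔m _ _)) p≤
          ∷ᵇ Bounded-mono γ (m≤m+n _ _) b)
        (under₂-represents x xs ρ≈)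
  in _ , match-node dp ds , s≤s (+-mono-≤ cp (≤-trans cs (m≤n+m _ _)))
case p q s .sized {N = N} γ b
  with eval p γ | ≤-trans (sized p γ b) (m≤n+m (⟦ size p ⟧ₚ N) N)
... | []     | _  = ≤-trans (sized q γ b) (m≤m+n _ _)
... | x ∷ xs | p≤ = ≤-trans
  (sized s _ (≤-trans (m≤m⊔n _ _) p≤ ∷ᵇ ≤-trans (≤-trans (n≤1+n _) (m≤n⊔m _ _)) p≤
    ∷ᵇ Bounded-mono γ (m≤m+n _ _) b))
  (m≤n+m _ _)

unary : ℕ → List ⊤
unary k = replicate k tt

encode-unary : ∀ k → encodeList (λ (_ : ⊤) → leaf) (unary k) ≡ encodeℕ k
encode-unary zero    = refl
encode-unary (suc k) = cong (node leaf) (encode-unary k)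

-- A vertex and its index have the same encoding, so the conversion is free and only changes the
-- type.
index : Prog Γ vtx → Prog Γ nat
index p .eval γ = unary (toℕ (eval p γ))
index p .code   = code p
index p .time   = time p
index p .size   = size p
index p .runs γ r ρ b ρ≈ =
  let c , d , c≤ = runs p γ r ρ b ρ≈
  in c , subst (λ v → ρ ⊢ code p r ⇓ v [ c ]) (sym (encode-unary (toℕ (eval p γ)))) d , c≤
index {Γ} p .sized {n} {N} γ b =
  subst (_≤ ⟦ size p ⟧ₚ N) (sym (width-unary (toℕ (eval p γ)))) (sized p γ b)
  where
  width-unary : ∀ k → width {n} nat (unary k) ≡ k
  width-unary zero    = refl
  width-unary (suc k) = cong suc (width-unary k)

length≤width : ∀ σ (xs : List (⟦ σ ⟧ n)) → List.length xs ≤ width (list σ) xs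
length≤width σ []       = z≤n
length≤width σ (x ∷ xs) = ≤-trans (s≤s (length≤width σ xs)) (m≤n⊔m (width σ x) _)

-- Iteration over lists

module _ (p : Prog Γ (list σ)) (q : Prog Γ τ) (s : Prog (τ ∷ σ ∷ Γ) τ) where

  iterate : Vals n Γ → List (⟦ σ ⟧ n) → ⟦ τ ⟧ n
  iterate γ = foldr (λ x a → eval s (a ∷ x ∷ γ)) (eval q γ)

  private
    Q : Poly
    Q = X ⊕ size p

    -- Six rule instances per element surround the code of `s`: the match and its scrutinee, the
    -- binding, and the application with its two variables.
    step : Poly → Poly
    step B = con 6 ⊕ time s ⟨ Q ⊕ B ⟨ Q ⟩ ⟩

    p≤ : (γ : Vals n Γ) → Bounded N γ → width (list σ) (eval p γ) ≤ ⟦ Q ⟧ₚ N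
    p≤ {N = N} γ b = ≤-trans (sized p γ b) (m≤n+m _ N)

    -- Five values lie above `ρ` when the step runs: the accumulator, the head, the tail, the
    -- argument and the recursive closure.
    inStep : Renaming Γ m → Renaming (τ ∷ σ ∷ Γ) (5 + m)
    inStep r _ (here _)          = zero
    inStep r _ (there (here _))  = suc zero
    inStep r _ (there (there x)) = suc (suc (suc (suc (suc (r _ x)))))

    body : Renaming Γ m → Term (2 + m)
    body r = match (var zero)
      (code q λ σ x → suc (suc (r σ x)))
      (bind (app (var (suc (suc (suc zero)))) (var (suc zero))) (code s (inStep r)))

    -- Composing the size bound of `s` with itself once per element would not yield a polynomial, so
    -- a bound valid for all intermediate accumulators has to be supplied from outside.
    Grows : Poly → Set
    Grows B = ∀ {n N} (γ : Vals n Γ) xs → Bounded N γ → width (list σ) xs ≤ N →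
      width τ (iterate γ xs) ≤ ⟦ B ⟧ₚ N

    -- A suffix is no wider than the whole list, so one `M` bounds the scope of every recursive call
    -- and each element is charged the same amount.
    loop : ∀ {B} → Grows B → ∀ (γ : Vals n Γ) (r : Renaming Γ m) (ρ : Env m) {M} →
      Bounded M γ → Represents ρ r γ → ∀ xs → width (list σ) xs ≤ M →
      enc (list σ) xs ∷ closure ρ (body r) ∷ ρ ⊢ body r ⇓ enc τ (iterate γ xs) within
        2 + ⟦ time q ⟧ₚ M + List.length xs * (6 + ⟦ time s ⟧ₚ (M + ⟦ B ⟧ₚ M))
    loop {B = B} grows γ r ρ b ρ≈ [] _ =
      let _ , dq , cq = runs q γ (λ σ x → suc (suc (r σ x))) _ b ρ≈
      in _ , match-leaf var dq , s≤s (s≤s (≤-trans cq (m≤m+n _ 0)))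
    loop {B = B} grows γ r ρ {M} b ρ≈ (x ∷ xs) x∷xs≤M =
      let xs≤M        = ≤-trans (≤-trans (n≤1+n _) (m≤n⊔m (width σ x) _)) x∷xs≤M
          x≤M         = ≤-trans (m≤m⊔n _ _) x∷xs≤M
          a           = iterate γ xs
          _ , di , ci = loop {B = B} grows γ r ρ b ρ≈ xs xs≤M
          _ , ds , cs = runs s (a ∷ x ∷ γ) (inStep r)
            (enc τ a ∷ enc σ x ∷ enc (list σ) xs ∷ enc (list σ) (x ∷ xs) ∷ closure ρ (body r) ∷ ρ)
            (≤-trans (grows γ xs b xs≤M) (m≤n+m _ M)
              ∷ᵇ ≤-trans x≤M (m≤m+n _ _) ∷ᵇ Bounded-mono γ (m≤m+n _ _) b)
            λ { _ (here refl) → refl ; _ (there (here refl)) → refl ; _ (there (there i)) → ρ≈ _ i }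
      in _ , match-node var (bind (app var var di) ds) ,
         ≤-trans (s≤s (s≤s (s≤s (+-mono-≤ (s≤s (s≤s (s≤s ci))) cs))))
           (≤-reflexive (rearrange (⟦ time q ⟧ₚ M) (List.length xs) (⟦ time s ⟧ₚ (M + ⟦ B ⟧ₚ M))))
      where
      open +-*-Solver
      rearrange : ∀ q l s → 6 + (2 + q + l * (6 + s)) + s ≡ 2 + q + suc l * (6 + s)
      rearrange = solve 3 (λ q l s → con 6 :+ (con 2 :+ q :+ l :* (con 6 :+ s)) :+ s
        := con 2 :+ q :+ (con 1 :+ l) :* (con 6 :+ s)) refl

  fold : (B : Poly) → Grows B → Prog Γ τ
  fold B grows .eval γ = iterate γ (eval p γ)
  fold B grows .code r = app (fun (body r)) (code p r)
  fold B grows .time   = con 2 ⊕ time p ⊕ (con 2 ⊕ time q ⟨ Q ⟩ ⊕ Q ⊗ step B)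
  fold B grows .size   = B ⟨ Q ⟩
  fold B grows .runs {N = N} γ r ρ b ρ≈ =
    let _ , dp , cp = runs p γ r ρ b ρ≈
        _ , df , cf = loop {B = B} grows γ r ρ {⟦ Q ⟧ₚ N} (Bounded-mono γ (m≤m+n _ _) b) ρ≈ (eval p γ) (p≤ γ b)
    in _ , app fun dp df , s≤s (+-mono-≤ (s≤s cp)
         (≤-trans cf (+-monoʳ-≤ (2 + ⟦ time q ⟧ₚ (⟦ Q ⟧ₚ N))
           (*-monoˡ-≤ (⟦ step B ⟧ₚ N) (≤-trans (length≤width σ (eval p γ)) (p≤ γ b))))))
  fold B grows .sized γ b = grows γ (eval p γ) (Bounded-mono γ (m≤m+n _ _) b) (p≤ γ b)

-- Growth of accumulators, and list programs

∈-width : ∀ σ {x : ⟦ σ ⟧ n} {xs} → x ∈ₗ xs → width σ x ≤ width (list σ) xs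
∈-width σ (here refl)        = m≤m⊔n _ _
∈-width σ {xs = y ∷ _} (there x∈) = ≤-trans (∈-width σ x∈) (≤-trans (n≤1+n _) (m≤n⊔m (width σ y) _))

-- The effect of consing an entry of width `a` onto a list of width `b`.
cons-growth : ∀ {a b c} → a ≤ c → a ⊔ suc b ≤ b + (c + 1)
cons-growth {a} {b} {c} a≤c = ⊔-lub
  (≤-trans a≤c (≤-trans (m≤m+n c 1) (m≤n+m _ b)))
  (≤-trans (≤-reflexive (+-comm 1 b)) (+-monoʳ-≤ b (m≤n+m 1 c)))

module _ (σ τ : Ty) {f : ⟦ σ ⟧ n → ⟦ τ ⟧ n → ⟦ τ ⟧ n} {b : ⟦ τ ⟧ n} {K p : ℕ} where

  -- Only accumulators wider than B are required to grow slowly.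
  foldr-growth-above : ∀ {B} →
    (∀ x a {M} → width σ x ≤ K → B ≤ M → width τ a ≤ M → width τ (f x a) ≤ M + p) →
    width τ b ≤ B → ∀ xs → width (list σ) xs ≤ K → width τ (foldr f b xs) ≤ B + K * p
  foldr-growth-above {B} step b≤B xs xs≤K = ≤-trans (go xs xs≤K)
    (+-monoʳ-≤ B (*-monoˡ-≤ p (≤-trans (length≤width σ xs) xs≤K)))
    where
    go : ∀ xs → width (list σ) xs ≤ K → width τ (foldr f b xs) ≤ B + List.length xs * p
    go []       _ = ≤-trans b≤B (m≤m+n _ 0)
    go (x ∷ xs) x∷xs≤K = ≤-trans
      (step x _ (≤-trans (m≤m⊔n _ _) x∷xs≤K) (m≤m+n B _)
        (go xs (≤-trans (≤-trans (n≤1+n _) (m≤n⊔m (width σ x) _)) x∷xs≤K)))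
      (≤-reflexive (trans (+-assoc B _ p) (cong (B +_) (+-comm (List.length xs * p) p))))

  foldr-growth : (∀ x a → width σ x ≤ K → width τ (f x a) ≤ width τ a + p) →
    ∀ xs → width (list σ) xs ≤ K → width τ (foldr f b xs) ≤ width τ b + K * p
  foldr-growth step = foldr-growth-above
    (λ x a x≤K _ a≤M → ≤-trans (step x a x≤K) (+-monoˡ-≤ p a≤M)) ≤-refl

-- A step whose increment is bounded independently of the accumulator makes growth additive, so the
-- whole fold stays polynomial.
foldGrow : (p : Prog Γ (list σ)) (q : Prog Γ τ) (s : Prog (τ ∷ σ ∷ Γ) τ) (G : Poly) →
  (∀ {n N} (γ : Vals n Γ) x a → Bounded N (x ∷ γ) →
     width τ (eval s (a ∷ x ∷ γ)) ≤ width τ a + ⟦ G ⟧ₚ N) →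
  Prog Γ τ
foldGrow {σ = σ} {τ} p q s G growth = fold p q s (size q ⊕ X ⊗ G) λ γ xs b xs≤N →
  ≤-trans (foldr-growth σ τ (λ x a x≤N → growth γ x a (x≤N ∷ᵇ b)) xs xs≤N)
    (+-monoˡ-≤ _ (sized q γ b))

truth : Prog Γ nat
truth = cons star nil

opaque
  append : Prog Γ (list σ) → Prog Γ (list σ) → Prog Γ (list σ)
  append p q = foldGrow p q (cons #1 #0) (X ⊕ con 1) λ γ x a b → cons-growth (b _ (here refl))

  drop : Prog Γ (list σ) → Prog Γ (list τ) → Prog Γ (list τ)
  drop {τ = τ} p q = foldGrow p q (case #0 nil #1) (con 0) λ where
    γ x []       b → z≤n
    γ x (y ∷ ys) b → ≤-trans (≤-trans (n≤1+n _) (m≤n⊔m (width τ y) _)) (m≤m+n _ 0)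

  -- Folding from the right lets an earlier hit replace all later ones. As the empty list means
  -- failure, the same program is both an existential quantifier and a search that returns its find.
  first : Prog Γ (list σ) → Prog (σ ∷ Γ) (list τ) → Prog Γ (list τ)
  first {τ = τ} p q = foldGrow p nil (case (wk q) #0 (cons #0 #1)) (size q) λ γ x a b →
    growth (eval q (x ∷ γ)) a (sized q (x ∷ γ) b)
    where
    growth : ∀ {n K} (ys a : List (⟦ τ ⟧ n)) → width (list τ) ys ≤ K →
      width (list τ) (caseList ys a _∷_) ≤ width (list τ) a + K
    growth []       a _    = m≤m+n _ _
    growth (y ∷ ys) a ys≤K = ≤-trans ys≤K (m≤n+m _ _)

  every : Prog Γ (list σ) → Prog (σ ∷ Γ) (list τ) → Prog Γ nat
  every {τ = τ} p q = foldGrow p truth (case (wk q) nil #2) (con 0) λ {n} γ x a b → growth {n} (eval q (x ∷ γ)) a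
    where
    growth : ∀ {n} (ys : List (⟦ τ ⟧ n)) (a : ⟦ nat ⟧ n) →
      width {n} nat (caseList ys [] λ _ _ → a) ≤ width {n} nat a + 0
    growth []      a = z≤n
    growth {n} (_ ∷ _) a = m≤m+n (width {n} nat a) 0

  -- Only the head of each answer is kept, so the list gains at most one entry per `x`.
  collect : Prog Γ (list σ) → Prog Γ (list τ) → Prog (σ ∷ Γ) (list τ) → Prog Γ (list τ)
  collect {τ = τ} p q s = foldGrow p q (case (wk s) #0 (cons #0 #2)) (size s ⊕ con 1) λ γ x a b →
    growth (eval s (x ∷ γ)) a (sized s (x ∷ γ) b)
    where
    growth : ∀ {n K} (ys a : List (⟦ τ ⟧ n)) → width (list τ) ys ≤ K →
      width (list τ) (caseList ys a λ y _ → y ∷ a) ≤ width (list τ) a + (K + 1)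
    growth []       a _    = m≤m+n _ _
    growth (y ∷ ys) a ys≤K = cons-growth (≤-trans (m≤m⊔n _ _) ys≤K)

  both : Prog Γ (list σ) → Prog Γ (list τ) → Prog Γ (list τ)
  both p q = case p nil (wk (wk q))

  implies : Prog Γ (list σ) → Prog Γ nat → Prog Γ nat
  implies p q = case p truth (wk (wk q))

  leq : Prog Γ nat → Prog Γ nat → Prog Γ nat
  leq p q = case (drop q p) truth nil

  equal : Prog Γ nat → Prog Γ nat → Prog Γ nat
  equal p q = both (leq p q) (leq q p)

  same : Prog Γ vtx → Prog Γ vtx → Prog Γ nat
  same p q = equal (index p) (index q)

  member : Prog Γ vtx → Prog Γ (list vtx) → Prog Γ nat
  member p q = first q (same (wk p) #0)

  entryAt : Prog Γ vtx → Prog Γ (list (list τ)) → Prog Γ (list τ)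
  entryAt p q = case (drop (index p) q) nil #0

  -- Each element seen increments the numbers collected so far and puts 0 in front of them.
  numbers : Prog Γ (list σ) → Prog Γ (list nat)
  numbers p = foldGrow p nil (cons nil successors) (con 2) λ γ x a b →
    ≤-trans (s≤s (growth a)) (≤-reflexive (+-comm 2 _))
    where
    successors : Prog (list nat ∷ Γ) (list nat)
    successors = foldGrow #0 nil (cons (cons star #1) #0) (con 1 ⊕ X ⊕ con 1) λ γ x a b →
      cons-growth (s≤s (b _ (here refl)))

    -- The generic size bound of `successors` depends on the accumulator, which `foldGrow` does not
    -- allow. Since every entry gains exactly one, the width rises by at most one.
    growth : (a : List (List ⊤)) →
      width {n} (list nat) (foldr (λ x ys → (tt ∷ x) ∷ ys) [] a) ≤ suc (width {n} (list nat) a)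
    growth []      = z≤n
    growth (x ∷ a) = ⊔-lub (s≤s (m≤m⊔n _ _)) (s≤s (≤-trans (growth a) (m≤n⊔m _ _)))

-- Specifications of the list programs

Holds : List A → Set
Holds xs = ∃ (_∈ₗ xs)

nonempty : {xs : List A} → Holds xs → xs ≢ []
nonempty (_ , ()) refl

opaque
  unfolding drop

  drop-spec : (p : Prog Γ (list σ)) (q : Prog Γ (list τ)) (γ : Vals n Γ) →
    eval (drop p q) γ ≡ List.drop (List.length (eval p γ)) (eval q γ)
  drop-spec p q γ = go (eval p γ)
    where
    tail-drop : ∀ k (ys : List A) → caseList (List.drop k ys) [] (λ _ zs → zs) ≡ List.drop (suc k) ys
    tail-drop zero    []       = refl
    tail-drop zero    (y ∷ ys) = refl
    tail-drop (suc k) []       = refl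
    tail-drop (suc k) (y ∷ ys) = tail-drop k ys

    go : (xs : List A) →
      foldr (λ _ ys → caseList ys [] λ _ zs → zs) (eval q γ) xs ≡ List.drop (List.length xs) (eval q γ)
    go []       = refl
    go (x ∷ xs) = trans (cong (λ ys → caseList ys [] λ _ zs → zs) (go xs))
                        (tail-drop (List.length xs) (eval q γ))

module _ (p : Prog Γ (list σ)) (q : Prog (σ ∷ Γ) (list τ)) (γ : Vals n Γ) where
  opaque
    unfolding first

    private
      go : List (⟦ σ ⟧ n) → List (⟦ τ ⟧ n)
      go = foldr (λ x a → caseList (eval q (x ∷ γ)) a _∷_) []

      go-holds : ∀ xs {x} → x ∈ₗ xs → Holds (eval q (x ∷ γ)) → Holds (go xs)
      go-holds (x ∷ xs) x∈ h with eval q (x ∷ γ) in eq | x∈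
      ... | z ∷ zs | _         = z , here refl
      ... | []     | here refl = contradiction eq (nonempty h)
      ... | []     | there x∈′ = go-holds xs x∈′ h

    first-≡ : Holds (eval (first p q) γ) →
      ∃ λ x → x ∈ₗ eval p γ × eval (first p q) γ ≡ eval q (x ∷ γ)
    first-≡ = search (eval p γ)
      where
      search : ∀ xs → Holds (go xs) → ∃ λ x → x ∈ₗ xs × go xs ≡ eval q (x ∷ γ)
      search (x ∷ xs) h with eval q (x ∷ γ) in eq
      ... | z ∷ zs = x , here refl , sym eq
      ... | []     = let x′ , x′∈ , eq′ = search xs h in x′ , there x′∈ , eq′

    -- Applied to the increasing list of radii: the radius selected is at most any radius `i` known
    -- to succeed.
    first-least : ∀ {k} (f : Fin k → ⟦ σ ⟧ n) → eval p γ ≡ tabulate f →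
      ∀ {i} → Holds (eval q (f i ∷ γ)) →
      ∃ λ j → toℕ j ≤ toℕ i × eval (first p q) γ ≡ eval q (f j ∷ γ) × Holds (eval q (f j ∷ γ))
    first-least f eq {i} h = subst (λ xs → ∃ λ j → toℕ j ≤ toℕ i × go xs ≡ eval q (f j ∷ γ) × Holds (eval q (f j ∷ γ)))
      (sym eq) (search f i h)
      where
      search : ∀ {k} (f : Fin k → ⟦ σ ⟧ n) i → Holds (eval q (f i ∷ γ)) →
        ∃ λ j → toℕ j ≤ toℕ i × go (tabulate f) ≡ eval q (f j ∷ γ) × Holds (eval q (f j ∷ γ))
      search f zero h with eval q (f zero ∷ γ) in eq
      ... | z ∷ zs = zero , z≤n , sym eq , subst Holds (sym eq) h
      ... | []     = contradiction refl (nonempty h)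
      search f (suc i) h with eval q (f zero ∷ γ) in eq
      ... | z ∷ zs = zero , z≤n , sym eq , subst Holds (sym eq) (z , here refl)
      ... | []     = let j , j≤i , eq′ , h′ = search (f ∘ suc) i h in suc j , s≤s j≤i , eq′ , h′

    first-∈ : ∀ {y} → y ∈ₗ eval (first p q) γ → ∃ λ x → x ∈ₗ eval p γ × y ∈ₗ eval q (x ∷ γ)
    first-∈ y∈ = let x , x∈ , eq = first-≡ (_ , y∈) in x , x∈ , subst (_ ∈ₗ_) eq y∈

    first-spec : Holds (eval (first p q) γ) ⇔ ∃ λ x → x ∈ₗ eval p γ × Holds (eval q (x ∷ γ))
    first-spec = mk⇔
      (λ (y , y∈) → let x , x∈ , y∈q = first-∈ y∈ in x , x∈ , y , y∈q)
      (λ (x , x∈ , h) → go-holds (eval p γ) x∈ h)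

opaque
  unfolding every

  every-spec : (p : Prog Γ (list σ)) (q : Prog (σ ∷ Γ) (list τ)) (γ : Vals n Γ) →
    Holds (eval (every p q) γ) ⇔ (∀ x → x ∈ₗ eval p γ → Holds (eval q (x ∷ γ)))
  every-spec {σ = σ} {n = n} p q γ = mk⇔ (λ h x → to-all (eval p γ) h) (from-all (eval p γ))
    where
    all′ : List (⟦ σ ⟧ n) → List ⊤
    all′ = foldr (λ x a → caseList (eval q (x ∷ γ)) [] λ _ _ → a) (tt ∷ [])
    to-all : (xs : List (⟦ σ ⟧ n)) → Holds (all′ xs) → ∀ {x} → x ∈ₗ xs → Holds (eval q (x ∷ γ))
    to-all (x ∷ xs) h x∈ with eval q (x ∷ γ) in eq | x∈
    to-all (x ∷ xs) (_ , ()) x∈ | []     | _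
    ... | z ∷ zs | here refl = z , subst (z ∈ₗ_) (sym eq) (here refl)
    ... | z ∷ zs | there x∈  = to-all xs h x∈
    from-all : (xs : List (⟦ σ ⟧ n)) → (∀ x → x ∈ₗ xs → Holds (eval q (x ∷ γ))) → Holds (all′ xs)
    from-all []       h = tt , here refl
    from-all (x ∷ xs) h with eval q (x ∷ γ) | h x (here refl)
    ... | z ∷ zs | _      = from-all xs λ x x∈ → h x (there x∈)

module _ (p : Prog Γ (list σ)) (q : Prog Γ (list τ)) (s : Prog (σ ∷ Γ) (list τ)) (γ : Vals n Γ) where
  opaque
    unfolding collect

    private
      go : List (⟦ σ ⟧ n) → List (⟦ τ ⟧ n)
      go = foldr (λ x a → caseList (eval s (x ∷ γ)) a λ y _ → y ∷ a) (eval q γ)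

    -- When `M` bounds the initial list and every new entry alike, a cons raises the bound by one
    -- only; the widths of the entries do not add up.
    collect-width : ∀ {K M} →
      (∀ x {y} → width σ x ≤ K → y ∈ₗ eval s (x ∷ γ) → width τ y ≤ M) →
      width (list τ) (eval q γ) ≤ M → width (list σ) (eval p γ) ≤ K →
      width (list τ) (eval (collect p q s) γ) ≤ M + K * 1
    collect-width {K} {M} new≤ base≤ = foldr-growth-above σ (list τ) {b = eval q γ}
      (λ x a x≤K M≤ a≤ → step (eval s (x ∷ γ)) (λ y∈ → ≤-trans (new≤ x x≤K y∈) M≤) a≤)
      base≤ (eval p γ)
      where
      step : ∀ {M} (ys : List (⟦ τ ⟧ n)) {a} → (∀ {y} → y ∈ₗ ys → width τ y ≤ M) →
        width (list τ) a ≤ M → width (list τ) (caseList ys a λ y _ → y ∷ a) ≤ M + 1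
      step []       _   a≤ = ≤-trans a≤ (m≤m+n _ 1)
      step (y ∷ ys) ys≤ a≤ = ⊔-lub (≤-trans (ys≤ (here refl)) (m≤m+n _ 1))
        (≤-trans (s≤s a≤) (≤-reflexive (+-comm 1 _)))

    collect-base : ∀ {y} → y ∈ₗ eval q γ → y ∈ₗ eval (collect p q s) γ
    collect-base {y} y∈ = base (eval p γ)
      where
      base : ∀ xs → y ∈ₗ go xs
      base []       = y∈
      base (x ∷ xs) with eval s (x ∷ γ)
      ... | []    = base xs
      ... | _ ∷ _ = there (base xs)

    collect-new : ∀ {x} → x ∈ₗ eval p γ → Holds (eval s (x ∷ γ)) →
      ∃ λ y → y ∈ₗ eval s (x ∷ γ) × y ∈ₗ eval (collect p q s) γ
    collect-new x∈ h = new (eval p γ) x∈ h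
      where
      new : ∀ xs {x} → x ∈ₗ xs → Holds (eval s (x ∷ γ)) → ∃ λ y → y ∈ₗ eval s (x ∷ γ) × y ∈ₗ go xs
      new (x ∷ xs) (here refl) h with eval s (x ∷ γ) in eq
      ... | []    = contradiction refl (nonempty h)
      ... | z ∷ _ = z , here refl , here refl
      new (x ∷ xs) (there x∈) h with eval s (x ∷ γ) | new xs x∈ h
      ... | []    | new′          = new′
      ... | _ ∷ _ | y , y∈s , y∈ = y , y∈s , there y∈

    collect-∈ : ∀ {y} → y ∈ₗ eval (collect p q s) γ →
      (∃ λ x → x ∈ₗ eval p γ × y ∈ₗ eval s (x ∷ γ)) ⊎ y ∈ₗ eval q γ
    collect-∈ = split′ (eval p γ)
      where
      split′ : ∀ xs {y} → y ∈ₗ go xs → (∃ λ x → x ∈ₗ xs × y ∈ₗ eval s (x ∷ γ)) ⊎ y ∈ₗ eval q γ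
      split′ [] y∈ = inj₂ y∈
      split′ (x ∷ xs) y∈ with eval s (x ∷ γ) in eq | y∈
      ... | []    | y∈′ = Sum.map₁ (λ (x′ , x′∈ , h) → x′ , there x′∈ , h) (split′ xs y∈′)
      ... | z ∷ _ | here refl = inj₁ (x , here refl , subst (_ ∈ₗ_) (sym eq) (here refl))
      ... | _ ∷ _ | there y∈′ = Sum.map₁ (λ (x′ , x′∈ , h) → x′ , there x′∈ , h) (split′ xs y∈′)

opaque
  unfolding append both implies leq equal same member entryAt numbers

  both-spec : (p : Prog Γ (list σ)) (q : Prog Γ (list τ)) (γ : Vals n Γ) →
    Holds (eval (both p q) γ) ⇔ (Holds (eval p γ) × Holds (eval q γ))
  both-spec p q γ with eval p γ
  ... | []     = mk⇔ (λ { (_ , ()) }) (λ { ((_ , ()) , _) })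
  ... | x ∷ xs = mk⇔ (λ h → (x , here refl) , h) proj₂

  implies-spec : (p : Prog Γ (list σ)) (q : Prog Γ nat) (γ : Vals n Γ) →
    Holds (eval (implies p q) γ) ⇔ (Holds (eval p γ) → Holds (eval q γ))
  implies-spec p q γ with eval p γ
  ... | []     = mk⇔ (λ { _ (_ , ()) }) (λ _ → tt , here refl)
  ... | x ∷ xs = mk⇔ (λ h _ → h) (λ f → f (x , here refl))

  append-spec : (p q : Prog Γ (list σ)) (γ : Vals n Γ) → eval (append p q) γ ≡ eval p γ ++ eval q γ
  append-spec p q γ = go (eval p γ)
    where
    go : ∀ xs → foldr _∷_ (eval q γ) xs ≡ xs ++ eval q γ
    go []       = refl
    go (x ∷ xs) = cong (x ∷_) (go xs)

  leq-spec : (p q : Prog Γ nat) (γ : Vals n Γ) →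
    Holds (eval (leq p q) γ) ⇔ List.length (eval p γ) ≤ List.length (eval q γ)
  leq-spec p q γ rewrite drop-spec q p γ = go (List.length (eval q γ)) (eval p γ)
    where
    go : ∀ k (xs : List ⊤) → Holds (caseList (List.drop k xs) (tt ∷ []) λ _ _ → []) ⇔ List.length xs ≤ k
    go zero    []       = mk⇔ (λ _ → z≤n) (λ _ → tt , here refl)
    go zero    (x ∷ xs) = mk⇔ (λ { (_ , ()) }) (λ ())
    go (suc k) []       = mk⇔ (λ _ → z≤n) (λ _ → tt , here refl)
    go (suc k) (x ∷ xs) = mk⇔ (s≤s ∘ to (go k xs)) (λ { (s≤s xs≤k) → from (go k xs) xs≤k })

  equal-spec : (p q : Prog Γ nat) (γ : Vals n Γ) →
    Holds (eval (equal p q) γ) ⇔ List.length (eval p γ) ≡ List.length (eval q γ)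
  equal-spec p q γ = mk⇔
    (λ h → let h₁ , h₂ = to (both-spec (leq p q) (leq q p) γ) h
           in ≤-antisym (to (leq-spec p q γ) h₁) (to (leq-spec q p γ) h₂))
    (λ eq → from (both-spec (leq p q) (leq q p) γ)
      (from (leq-spec p q γ) (≤-reflexive eq) , from (leq-spec q p γ) (≤-reflexive (sym eq))))

  same-spec : (p q : Prog Γ vtx) (γ : Vals n Γ) → Holds (eval (same p q) γ) ⇔ eval p γ ≡ eval q γ
  same-spec p q γ = mk⇔
    (λ h → toℕ-injective (trans (sym (length-replicate _)) (trans (to (equal-spec (index p) (index q) γ) h) (length-replicate _))))
    (λ eq → from (equal-spec (index p) (index q) γ) (cong (λ u → List.length (unary (toℕ u))) eq))

  member-spec : (p : Prog Γ vtx) (q : Prog Γ (list vtx)) (γ : Vals n Γ) →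
    Holds (eval (member p q) γ) ⇔ eval p γ ∈ₗ eval q γ
  member-spec p q γ = mk⇔
    (λ h → let x , x∈ , e = to (first-spec q (same (wk p) #0) γ) h
           in subst (_∈ₗ eval q γ) (sym (to (same-spec (wk p) #0 (x ∷ γ)) e)) x∈)
    (λ p∈ → from (first-spec q (same (wk p) #0) γ) (_ , p∈ , from (same-spec (wk p) #0 (_ ∷ γ)) refl))

  entryAt-spec : (p : Prog Γ vtx) (q : Prog Γ (list (list τ))) (γ : Vals n Γ) (f : Fin n → List (⟦ τ ⟧ n)) →
    eval q γ ≡ map f (allFin n) → eval (entryAt p q) γ ≡ f (eval p γ)
  entryAt-spec {n = n} p q γ f eq
    rewrite drop-spec (index p) q γ | length-replicate (toℕ (eval p γ)) {x = tt} | eq | map-tabulate {n = n} id f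
    = go f (eval p γ)
    where
    go : ∀ {k} (f : Fin k → List A) i → caseList (List.drop (toℕ i) (tabulate f)) [] (λ x _ → x) ≡ f i
    go f zero    = refl
    go f (suc i) = go (f ∘ suc) i

  numbers-spec : (p : Prog Γ (list σ)) (γ : Vals n Γ) →
    eval (numbers p) γ ≡ map (unary ∘ toℕ) (allFin (List.length (eval p γ)))
  numbers-spec {σ = σ} {n = n} p γ = trans (go (eval p γ)) (sym (map-tabulate id (unary ∘ toℕ)))
    where
    succ-tabulate : ∀ {k} (f : Fin k → List ⊤) →
      foldr (λ x ys → (tt ∷ x) ∷ ys) [] (tabulate f) ≡ tabulate ((tt ∷_) ∘ f)
    succ-tabulate {zero}  f = refl
    succ-tabulate {suc k} f = cong ((tt ∷ f zero) ∷_) (succ-tabulate (f ∘ suc))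
    go : (xs : List (⟦ σ ⟧ n)) → foldr (λ _ a → [] ∷ foldr (λ x ys → (tt ∷ x) ∷ ys) [] a) [] xs
      ≡ tabulate {n = List.length xs} (unary ∘ toℕ)
    go []       = refl
    go (x ∷ xs) = cong ([] ∷_) (trans (cong (foldr (λ x ys → (tt ∷ x) ∷ ys) []) (go xs)) (succ-tabulate (unary ∘ toℕ)))

-- Walks and distances

module _ {V : Set} {G : Graph V} where

  length-◅◅ : ∀ {x y z} (w : Walk G x y) (w′ : Walk G y z) → length (w ◅◅ w′) ≡ length w + length w′
  length-◅◅ ε       w′ = refl
  length-◅◅ (_ ◅ w) w′ = cong suc (length-◅◅ w w′)

  reversed : ∀ {x y} (w : Walk G x y) → Σ (Walk G y x) λ w′ → length w′ ≡ length w
  reversed ε       = ε , refl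
  reversed (e ◅ w) =
    let w′ , eq = reversed w
    in w′ ◅◅ (Graph.sym G e ◅ ε) ,
       trans (length-◅◅ w′ _) (trans (cong (_+ 1) eq) (+-comm _ 1))

  Shortest : ∀ {x y} → Walk G x y → Set
  Shortest {x} {y} w = ∀ (w′ : Walk G x y) → length w ≤ length w′

  suffix : ∀ {x y z} (w : Walk G x y) → z ∈ₗ vertices w → Σ (Walk G z y) λ w′ → length w′ ≤ length w
  suffix ε       (here refl) = ε , z≤n
  suffix (e ◅ w) (here refl) = e ◅ w , ≤-refl
  suffix (e ◅ w) (there z∈)  = let w′ , w′≤ = suffix w z∈ in w′ , m≤n⇒m≤1+n w′≤

  -- If the first vertex recurred, the part of the walk from the recurrence on would be shorter.
  shortest⇒simple : ∀ {x y} (w : Walk G x y) → Shortest w → Unique (vertices w)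
  shortest⇒simple ε       _        = [] ∷ []
  shortest⇒simple (e ◅ w) shortest =
    All.tabulate (λ { z∈ refl → let w′ , w′≤ = suffix w z∈ in <⇒≱ (s≤s w′≤) (shortest w′) })
    ∷ shortest⇒simple w λ w′ → ≤-pred (shortest (e ◅ w′))

  head-vertices : ∀ {x y c cs} (w : Walk G x y) → vertices w ≡ c ∷ cs → x ≡ c
  head-vertices ε       refl = refl
  head-vertices (_ ◅ _) refl = refl

  -- The target for indices beyond the end.
  at : ∀ {x y} → Walk G x y → ℕ → V
  at {x} ε           i       = x
  at {x} (_ ◅ _)     zero    = x
  at     (_ ◅ w)     (suc i) = at w i

  at-zero : ∀ {x y} (w : Walk G x y) → at w 0 ≡ x
  at-zero ε       = refl
  at-zero (_ ◅ _) = refl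

  at-length : ∀ {x y} (w : Walk G x y) → at w (length w) ≡ y
  at-length ε       = refl
  at-length (_ ◅ w) = at-length w

  at-adjacent : ∀ {x y} (w : Walk G x y) {i} → i < length w → Adj G (at w i) (at w (suc i))
  at-adjacent (e ◅ w) {zero}  _         rewrite at-zero w = e
  at-adjacent (_ ◅ w) {suc i} (s≤s i<) = at-adjacent w i<

  at-covers : ∀ {x y z} (w : Walk G x y) → z ∈ₗ vertices w → ∃ λ i → i ≤ length w × at w i ≡ z
  at-covers ε       (here refl) = 0 , z≤n , refl
  at-covers (_ ◅ w) (here refl) = 0 , z≤n , refl
  at-covers (_ ◅ w) (there z∈)  = let i , i≤ , eq = at-covers w z∈ in suc i , s≤s i≤ , eq

  -- Only an upper bound on the length, because indices beyond the end all denote the target.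
  segment : ∀ {x y} (w : Walk G x y) {i j} → i ≤ j →
    Σ (Walk G (at w i) (at w j)) λ w′ → length w′ ≤ j ∸ i
  segment ε       _ = ε , z≤n
  segment (e ◅ w) {j = zero}  z≤n = ε , z≤n
  segment {x = x} (e ◅ w) {j = suc j} z≤n =
    let w′ , w′≤ = subst (λ u → Σ (Walk G u (at w j)) λ w′ → length w′ ≤ j) (at-zero w) (segment w z≤n)
    in e ◅ w′ , s≤s w′≤
  segment (e ◅ w) (s≤s i≤j) = segment w i≤j

unique⇒length≤ : ∀ {n} (xs : List (Fin n)) → Unique xs → List.length xs ≤ n
unique⇒length≤ xs uniq = injective⇒≤ {f = List.lookup xs} (injective xs uniq)
  where
  injective : ∀ {A : Set} (xs : List A) → Unique xs → ∀ {i j} → List.lookup xs i ≡ List.lookup xs j → i ≡ j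
  injective (x ∷ xs) (x∉ ∷ u) {zero} {zero} _  = refl
  injective (x ∷ xs) (x∉ ∷ u) {zero} {suc j} eq = contradiction eq (All.lookup x∉ (∈-lookup j))
  injective (x ∷ xs) (x∉ ∷ u) {suc i} {zero} eq = contradiction (sym eq) (All.lookup x∉ (∈-lookup i))
  injective (x ∷ xs) (x∉ ∷ u) {suc i} {suc j} eq = cong suc (injective xs u eq)

path-length< : ∀ {n} {G : Graph (Fin n)} {u v} (p : Path G u v) → length (walk p) < n
path-length< {n} {G} p = subst (_≤ n) (vertices-length {G = G} (walk p)) (unique⇒length≤ _ (Path.simple p))
  where
  vertices-length : ∀ {n} {G : Graph (Fin n)} {u v} (w : Walk G u v) → List.length (vertices w) ≡ suc (length w)
  vertices-length ε       = refl
  vertices-length {G = G} (_ ◅ w) = cong suc (vertices-length {G = G} w)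

-- Metric, coverage and landmarks

module Metric {V : Set} (G : Graph V) (δ : V → V → ℕ)
  (realised : ∀ u v → Σ (Walk G u v) λ w → length w ≡ δ u v)
  (minimal : ∀ {u v} (w : Walk G u v) → δ u v ≤ length w) where

  δ-sym : ∀ u v → δ u v ≡ δ v u
  δ-sym u v = ≤-antisym (half u v) (half v u)
    where
    half : ∀ u v → δ u v ≤ δ v u
    half u v = let w , eq = realised v u
                   w′ , eq′ = reversed {G = G} w
               in ≤-trans (minimal w′) (≤-reflexive (trans eq′ eq))

  δ-refl : ∀ u → δ u u ≡ 0
  δ-refl u = n≤0⇒n≡0 (minimal ε)

  δ-triangle : ∀ u v x → δ u x ≤ δ u v + δ v x
  δ-triangle u v x =
    let w , eq = realised u v
        w′ , eq′ = realised v x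
    in ≤-trans (minimal (w ◅◅ w′)) (≤-reflexive (trans (length-◅◅ {G = G} w w′) (cong₂ _+_ eq eq′)))

  shortestPath : ∀ {u v} (w : Walk G u v) → length w ≡ δ u v → Σ (Path G u v) λ p → walk p ≡ w
  shortestPath w eq = record { walk = w ; simple = shortest⇒simple {G = G} w λ w′ → subst (_≤ length w′) (sym eq) (minimal w′) } , refl

  dist-δ : ∀ u v → Dist G u v (δ u v)
  dist-δ u v =
    let w , eq = realised u v
        p , peq = shortestPath w eq
    in (p , trans (cong length peq) eq) , λ { _ (p′ , refl) → minimal (walk p′) }

  dist≡δ : ∀ {u v d} → Dist G u v d → d ≡ δ u v
  dist≡δ {u} {v} ((p , refl) , least) =
    ≤-antisym (least _ (proj₁ (dist-δ u v))) (minimal (walk p))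

  Covered : List V → ℕ → V → Set
  Covered xs r v = ∃ λ x → x ∈ₗ xs × δ x v ≤ r

  distTo : ∀ {v r} (xs : List V) → Covered xs r v → ∃ λ d → DistTo G v xs d × d ≤ r
  distTo {v} {r} xs (x , x∈ , δ≤r) =
    δ v y₀ , ((y₀ , y₀∈ , dist-δ v y₀) ,
      λ { d (y , y∈ , Dy) → ≤-trans (All.lookup (f[argmin]≤f[xs] {f = δ v} x xs) y∈) (≤-reflexive (sym (dist≡δ Dy))) }) ,
    ≤-trans (f[argmin]≤f[⊤] {f = δ v} x xs) (≤-trans (≤-reflexive (δ-sym v x)) δ≤r)
    where
    y₀ : V
    y₀ = argmin (δ v) x xs
    y₀∈ : y₀ ∈ₗ xs
    y₀∈ with argmin-sel (δ v) x xs
    ... | inj₁ eq = subst (_∈ₗ xs) (sym eq) x∈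
    ... | inj₂ y₀∈′ = y₀∈′

  covered-distTo : ∀ {v d r} {xs : List V} → DistTo G v xs d → d ≤ r → Covered xs r v
  covered-distTo {v} ((x , x∈ , D) , _) d≤r =
    x , x∈ , ≤-trans (≤-reflexive (trans (δ-sym x v) (sym (dist≡δ D)))) d≤r

  -- Every vertex within ℓ of a shortest path is within ℓ + h of the landmarks
  -- on it, the vertices whose distance from its source is a multiple of 1 + h.
  module Landmarks {a b : V} (w : Walk G a b) (w-shortest : length w ≡ δ a b)
    (ℓ q : ℕ) .{{_ : NonZero q}} (covers : ∀ v → Covered (vertices w) ℓ v) where

    h g r k : ℕ
    h = ℓ ÷ q
    g = suc h
    r = ℓ + h
    k = 2 + 2 * q

    L : ℕ
    L = length w

    p : ℕ → V
    p = at {G = G} w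

    -- The last k landmarks up to p t, with p 0 repeated if there are fewer.
    window : ℕ → List V
    window t = applyUpTo (λ i → p ((t ÷ g ∸ i) * g)) k

    window-length : ∀ t → List.length (window t) ≡ k
    window-length t = length-applyUpTo (λ i → p ((t ÷ g ∸ i) * g)) k

    -- The prefix of `w` gives the upper bound. A shorter way to `p t`, continued along the rest of
    -- `w`, would beat `w` itself.
    level : ∀ {t} → t ≤ L → δ a (p t) ≡ t
    level {t} t≤L = ≤-antisym
      (let w′ , w′≤ = segment {G = G} w {0} {t} z≤n
       in subst (λ u → δ u (p t) ≤ t) (at-zero {G = G} w) (≤-trans (minimal w′) w′≤))
      (+-cancelʳ-≤ (L ∸ t) t (δ a (p t)) (begin
        t + (L ∸ t)               ≡⟨ m+[n∸m]≡n t≤L ⟩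
        L                         ≡⟨ w-shortest ⟩
        δ a b                     ≤⟨ δ-triangle a (p t) b ⟩
        δ a (p t) + δ (p t) b     ≤⟨ +-monoʳ-≤ (δ a (p t))
          (let w′ , w′≤ = segment {G = G} w t≤L
           in subst (λ u → δ (p t) u ≤ L ∸ t) (at-length {G = G} w) (≤-trans (minimal w′) w′≤)) ⟩
        δ a (p t) + (L ∸ t)       ∎))
      where open ≤-Reasoning

    window-zero : ∀ {x} → x ∈ₗ window 0 → x ≡ a
    window-zero x∈ with ∈-applyUpTo⁻ (λ i → p ((0 ÷ g ∸ i) * g)) x∈
    ... | i , _ , refl = trans (cong (λ m → p (m * g)) (trans (cong (_∸ i) (0/n≡0 g)) (0∸n≡0 i))) (at-zero {G = G} w)

    next-quotient : ∀ t → suc t ÷ g ≡ t ÷ g ⊎ (suc t ÷ g ≡ suc (t ÷ g) × suc t ≡ suc (t ÷ g) * g)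
    next-quotient t with suc (t % g) <? g
    ... | yes small = inj₁ (begin
      suc t ÷ g                         ≡⟨ cong (λ m → suc m ÷ g) (m≡m%n+[m/n]*n t g) ⟩
      (suc (t % g) + t ÷ g * g) ÷ g     ≡⟨ +-distrib-/-∣ʳ (suc (t % g)) (divides-refl (t ÷ g)) ⟩
      suc (t % g) ÷ g + t ÷ g * g ÷ g   ≡⟨ cong₂ _+_ (m<n⇒m/n≡0 small) (m*n/n≡m (t ÷ g) g) ⟩
      t ÷ g                             ∎)
      where open ≡-Reasoning
    ... | no ¬small = inj₂ (trans (cong (_÷ g) eq) (m*n/n≡m (suc (t ÷ g)) g) , eq)
      where
      eq : suc t ≡ suc (t ÷ g) * g
      eq = trans (cong suc (m≡m%n+[m/n]*n t g))
        (cong (_+ t ÷ g * g) (≤-antisym (m%n<n t g) (≮⇒≥ ¬small)))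

    -- This is the condition that `Edge` puts on consecutive lists. The window changes only when
    -- `suc t` is a multiple of `g`; then `p (suc t)` enters in front and the other landmarks move
    -- back by one.
    window-suc : ∀ t {x} → x ∈ₗ window (suc t) → x ∈ₗ p (suc t) ∷ window t
    window-suc t x∈ with ∈-applyUpTo⁻ (λ i → p ((suc t ÷ g ∸ i) * g)) x∈ | next-quotient t
    ... | i , i<k , refl | inj₁ eq rewrite eq = there (∈-applyUpTo⁺ (λ i → p ((t ÷ g ∸ i) * g)) i<k)
    ... | zero , i<k , refl | inj₂ (eq , eq′) rewrite eq = here (cong p (sym eq′))
    ... | suc i , i<k , refl | inj₂ (eq , eq′) rewrite eq = there (∈-applyUpTo⁺ (λ i → p ((t ÷ g ∸ i) * g)) (<-trans (n<1+n i) i<k))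

    landmark-nearby : ∀ i → i ≤ i ÷ g * g + h
    landmark-nearby i = begin
      i                     ≡⟨ m≡m%n+[m/n]*n i g ⟩
      i % g + i ÷ g * g     ≤⟨ +-monoˡ-≤ (i ÷ g * g) (≤-pred (m%n<n i g)) ⟩
      h + i ÷ g * g         ≡⟨ +-comm h _ ⟩
      i ÷ g * g + h         ∎
      where open ≤-Reasoning

    -- As ℓ ≤ q g, one has t ≤ i + 2 ℓ + h < (i ÷ g) g + 2 g + 2 q g.
    recent : ∀ {t i} → t ≤ i + ℓ + r → t ÷ g ∸ i ÷ g < k
    recent {t} {i} t≤ = m<n+o⇒m∸n<o (t ÷ g) (i ÷ g) (m<n*o⇒m/o<n (begin-strict
      t                                              ≤⟨ t≤ ⟩
      i + ℓ + (ℓ + h)                                ≤⟨ +-monoˡ-≤ (ℓ + h) (+-monoˡ-≤ ℓ (landmark-nearby i)) ⟩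
      i ÷ g * g + h + ℓ + (ℓ + h)                    <⟨ n<1+n _ ⟩
      suc (i ÷ g * g + h + ℓ + (ℓ + h))              ≤⟨ n≤1+n _ ⟩
      2 + (i ÷ g * g + h + ℓ + (ℓ + h))              ≡⟨ solve 3 (λ x h ℓ → con 2 :+ (x :+ h :+ ℓ :+ (ℓ :+ h)) :=
                                                          x :+ con 2 :* (con 1 :+ h) :+ (ℓ :+ ℓ)) refl (i ÷ g * g) h ℓ ⟩
      i ÷ g * g + 2 * g + (ℓ + ℓ)                    ≤⟨ +-monoʳ-≤ (i ÷ g * g + 2 * g) (+-mono-≤ ℓ≤ ℓ≤) ⟩
      i ÷ g * g + 2 * g + (q * g + q * g)            ≡⟨ solve 3 (λ x g q → x :* g :+ con 2 :* g :+ (q :* g :+ q :* g) :=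
                                                          (x :+ (con 2 :+ con 2 :* q)) :* g) refl (i ÷ g) g q ⟩
      (i ÷ g + k) * g                                ∎))
      where
      open ≤-Reasoning
      open +-*-Solver
      ℓ≤ : ℓ ≤ q * g
      ℓ≤ = ≤-trans (≤-reflexive (m≡m%n+[m/n]*n ℓ q))
        (≤-trans (+-monoˡ-≤ (ℓ ÷ q * q) (<⇒≤ (m%n<n ℓ q))) (≤-reflexive (*-comm g q)))

    -- Let `p i` be within `ℓ` of `v`. The last landmark up to `p i` is at most `h` away from it,
    -- hence within `r` of `v`. It has not been forgotten by `recent`, as `δ a v ≤ i + ℓ`. It has
    -- already been reached because `i ≤ t`, which follows from `i ≤ L` in the first case of the
    -- disjunction and from `i ≤ δ a v + r` in the second.
    window-covers : ∀ {t v} → t ≤ L → t ≤ δ a v + r →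
      t ≡ L ⊎ δ a v + r ≡ t → Covered (window t) r v
    window-covers {t} {v} t≤L t≤ due with covers v
    ... | x , x∈ , δ≤ with at-covers {G = G} w x∈
    ... | i , i≤L , at≡x =
      p (i ÷ g * g) ,
      -- The landmark sits at position `t ÷ g ∸ i ÷ g` of the window.
      subst (λ m → p (m * g) ∈ₗ window t) (m∸[m∸n]≡n (/-monoˡ-≤ g i≤t))
        (∈-applyUpTo⁺ (λ j → p ((t ÷ g ∸ j) * g)) (recent {t} {i} t≤i+ℓ+r)) ,
      (begin
        δ (p (i ÷ g * g)) v                     ≤⟨ δ-triangle _ (p i) v ⟩
        δ (p (i ÷ g * g)) (p i) + δ (p i) v     ≤⟨ +-mono-≤ (≤-trans (minimal s) (≤-trans s≤ i-near)) δ≤ℓ ⟩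
        h + ℓ                                   ≡⟨ +-comm h ℓ ⟩
        r                                       ∎)
      where
      open ≤-Reasoning
      δ≤ℓ : δ (p i) v ≤ ℓ
      δ≤ℓ = subst (λ u → δ u v ≤ ℓ) (sym at≡x) δ≤
      s  = proj₁ (segment {G = G} w (m/n*n≤m i g))
      s≤ = proj₂ (segment {G = G} w (m/n*n≤m i g))
      i-near : i ∸ i ÷ g * g ≤ h
      i-near = m≤n+o⇒m∸n≤o i (i ÷ g * g) (landmark-nearby i)
      av≤ : δ a v ≤ i + ℓ
      av≤ = ≤-trans (δ-triangle a (p i) v) (+-mono-≤ (≤-reflexive (level i≤L)) δ≤ℓ)
      t≤i+ℓ+r : t ≤ i + ℓ + r
      t≤i+ℓ+r = ≤-trans t≤ (+-monoˡ-≤ r av≤)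
      i≤δ+r : i ≤ δ a v + r
      i≤δ+r = begin
        i                      ≡⟨ level i≤L ⟨
        δ a (p i)              ≤⟨ δ-triangle a v (p i) ⟩
        δ a v + δ v (p i)      ≤⟨ +-monoʳ-≤ (δ a v) (≤-trans (≤-reflexive (δ-sym v (p i))) (≤-trans δ≤ℓ (m≤m+n ℓ h))) ⟩
        δ a v + r              ∎
      i≤t : i ≤ t
      i≤t = [ (λ t≡L → ≤-trans i≤L (≤-reflexive (sym t≡L)))
            , (λ eq → ≤-trans i≤δ+r (≤-reflexive eq)) ]′ due

-- Distances and the search as programs

record Input (Γ : List Ty) : Set where
  no-eta-equality
  field
    verts : Prog Γ (list vtx)
    rows  : Prog Γ (list (list nat))

open Input

wkᵢ : Input Γ → Input (σ ∷ Γ)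
wkᵢ I .verts = wk (verts I)
wkᵢ I .rows  = wk (rows I)

wkᵢ² : ∀ {σ₁ σ₂} → Input Γ → Input (σ₁ ∷ σ₂ ∷ Γ)
wkᵢ² I = wkᵢ (wkᵢ I)

wkᵢ³ : ∀ {σ₁ σ₂ σ₃} → Input Γ → Input (σ₁ ∷ σ₂ ∷ σ₃ ∷ Γ)
wkᵢ³ I = wkᵢ (wkᵢ² I)

wkᵢ⁴ : ∀ {σ₁ σ₂ σ₃ σ₄} → Input Γ → Input (σ₁ ∷ σ₂ ∷ σ₃ ∷ σ₄ ∷ Γ)
wkᵢ⁴ I = wkᵢ² (wkᵢ² I)

bit : Bool → List ⊤
bit false = []
bit true  = tt ∷ []

adjacency : Graph (Fin n) → List (List (List ⊤))
adjacency {n} G = map (λ u → map (λ v → bit (adj? G u v)) (allFin n)) (allFin n)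

record Reads (G : Graph (Fin n)) (I : Input Γ) (γ : Vals n Γ) : Set where
  constructor reads
  field
    verts≡ : eval (verts I) γ ≡ allFin n
    rows≡  : eval (rows I) γ ≡ adjacency G

open Reads

wkᴿ : {G : Graph (Fin n)} {I : Input Γ} {γ : Vals n Γ} {x : ⟦ σ ⟧ n} →
  Reads G I γ → Reads G (wkᵢ {σ = σ} I) (x ∷ γ)
wkᴿ (reads p q) = reads p q

_∈ⱽ_ : {I : Input Γ} {G : Graph (Fin n)} {γ : Vals n Γ} → ∀ v → Reads G I γ → v ∈ₗ eval (verts I) γ
v ∈ⱽ R = subst (v ∈ₗ_) (sym (verts≡ R)) (∈-allFin v)

opaque
  adjacent : Input Γ → Prog Γ vtx → Prog Γ vtx → Prog Γ nat
  adjacent I u v = entryAt v (entryAt u (rows I))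

  adjacent-spec : {G : Graph (Fin n)} (I : Input Γ) {γ : Vals n Γ} → Reads G I γ → ∀ u v →
    Holds (eval (adjacent I u v) γ) ⇔ Adj G (eval u γ) (eval v γ)
  adjacent-spec {G = G} I {γ} R u v
    rewrite entryAt-spec v (entryAt u (rows I)) γ (bit ∘ adj? G (eval u γ)) (entryAt-spec u (rows I) γ _ (rows≡ R))
    = bit-spec (adj? G (eval u γ) (eval v γ))
    where
    bit-spec : ∀ b → Holds (bit b) ⇔ T b
    bit-spec false = mk⇔ (λ { (_ , ()) }) (λ ())
    bit-spec true  = mk⇔ (λ _ → tt) (λ _ → tt , here refl)

touches : Input Γ → Prog (vtx ∷ vtx ∷ Γ) nat
touches I = append (same #0 #1) (adjacent (wkᵢ² I) #0 #1)

hit : Input Γ → Prog Γ (list vtx) → Prog (vtx ∷ Γ) nat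
hit I B = first (wk B) (touches I)

opaque
  next : Input Γ → Prog Γ (list vtx) → Prog Γ (list vtx)
  next I B = collect (verts I) nil (case (hit I B) nil (cons #2 nil))

module _ {G : Graph (Fin n)} (I : Input Γ) (B : Prog Γ (list vtx)) {γ : Vals n Γ} (R : Reads G I γ) where
  private
    found : Prog (vtx ∷ Γ) (list vtx)
    found = case (hit I B) nil (cons #2 nil)

    found-spec : ∀ v {x} → x ∈ₗ eval found (v ∷ γ) ⇔ (x ≡ v × Holds (eval (hit I B) (v ∷ γ)))
    found-spec v with eval (hit I B) (v ∷ γ)
    ... | []    = mk⇔ (λ ()) (λ { (_ , _ , ()) })
    ... | y ∷ _ = mk⇔ (λ { (here refl) → refl , y , here refl }) (λ { (refl , _) → here refl })

    hit-spec : ∀ v → Holds (eval (hit I B) (v ∷ γ)) ⇔ ∃ λ w → w ∈ₗ eval B γ × (w ≡ v ⊎ Adj G w v)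
    hit-spec v = mk⇔
      (λ h → let w , w∈ , h′ = to (first-spec (wk B) (touches I) (v ∷ γ)) h in w , w∈ , to (or-spec w) h′)
      (λ (w , w∈ , h) → from (first-spec (wk B) (touches I) (v ∷ γ)) (w , w∈ , from (or-spec w) h))
      where
      or-spec : ∀ w → Holds (eval (touches I) (w ∷ v ∷ γ))
        ⇔ (w ≡ v ⊎ Adj G w v)
      or-spec w rewrite append-spec (same #0 #1) (adjacent (wkᵢ² I) #0 #1) (w ∷ v ∷ γ) = mk⇔
        (λ (y , y∈) → Sum.map (λ h → to (same-spec #0 #1 (w ∷ v ∷ γ)) (y , h))
          (λ h → to (adjacent-spec (wkᵢ² I) (wkᴿ {x = w} (wkᴿ {x = v} R)) #0 #1) (y , h))
          (∈-++⁻ (eval (same #0 #1) (w ∷ v ∷ γ)) y∈))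
        [ (λ eq → let y , y∈ = from (same-spec #0 #1 (w ∷ v ∷ γ)) eq in y , ∈-++⁺ˡ y∈)
        , (λ a → let y , y∈ = from (adjacent-spec (wkᵢ² I) {w ∷ v ∷ γ} (wkᴿ {x = w} (wkᴿ {x = v} R)) #0 #1) a
                 in y , ∈-++⁺ʳ (eval (same #0 #1) (w ∷ v ∷ γ)) y∈) ]′

  opaque
    unfolding next

    next-spec : ∀ v → v ∈ₗ eval (next I B) γ ⇔ ∃ λ w → w ∈ₗ eval B γ × (w ≡ v ⊎ Adj G w v)
    next-spec v = mk⇔ to′ from′
      where
      to′ : v ∈ₗ eval (next I B) γ → ∃ λ w → w ∈ₗ eval B γ × (w ≡ v ⊎ Adj G w v)
      to′ v∈ with collect-∈ (verts I) nil found γ v∈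
      ... | inj₁ (x , _ , v∈′) with to (found-spec x) v∈′
      ... | refl , h = to (hit-spec x) h
      from′ : (∃ λ w → w ∈ₗ eval B γ × (w ≡ v ⊎ Adj G w v)) → v ∈ₗ eval (next I B) γ
      from′ h with collect-new (verts I) nil found γ (v ∈ⱽ R)
        (v , from (found-spec v) (refl , from (hit-spec v) h))
      ... | y , y∈ , y∈next with to (found-spec v) y∈
      ... | refl , _ = y∈next

opaque
  unfolding next collect

  -- The bound does not mention `B`, because the result is selected from the vertices. Thus `balls`
  -- can apply `next` repeatedly without accumulating size.
  next-width : (I : Input Γ) (B : Prog Γ (list vtx)) (γ : Vals n Γ) {K : ℕ} →
    width (list vtx) (eval (verts I) γ) ≤ K → width (list vtx) (eval (next I B) γ) ≤ K * (K + 1)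
  next-width I B γ {K} = foldr-growth vtx (list vtx) {b = []} (λ v a v≤K → step (eval (hit I B) (v ∷ γ)) a v≤K) (eval (verts I) γ)
    where
    step : ∀ {n} {v : Fin n} (ys : List ⊤) (a : List (Fin n)) → toℕ v ≤ K →
      width (list vtx) (caseList (caseList ys [] λ _ _ → v ∷ []) a (λ y _ → y ∷ a)) ≤ width (list vtx) a + (K + 1)
    step []      a _   = m≤m+n _ _
    step (_ ∷ _) a v≤K = cons-growth v≤K

-- Membership is tested on the ball before it grows, so the counter counts the radii from 0 on whose
-- balls miss `v`.
distStep : Input Γ → Prog Γ vtx → Prog ((list vtx ×ₜ nat) ∷ vtx ∷ Γ) (list vtx ×ₜ nat)
distStep I v = split #0 (pair (next (wkᵢ⁴ I) #0)
  (case (member (wk⁴ v) #0) (cons star #1) #3))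

-- The accumulator holds the ball of radius i around u, and min i d(u,v).
balls : Input Γ → Prog Γ vtx → Prog Γ vtx → Prog Γ (list vtx ×ₜ nat)
balls I u v = foldGrow (verts I) (pair (cons u nil) nil) (distStep I v)
  (size (verts I) ⊗ (size (verts I) ⊕ con 1) ⊕ con 1)
  λ {_} {N} γ x (B , d) b → ⊔-lub
    (≤-trans (next-width (wkᵢ⁴ I) #0 (B ∷ d ∷ (B , d) ∷ x ∷ γ)
        (sized (verts I) γ λ σ i → b σ (there i)))
      (≤-trans (m≤m+n _ 1) (m≤n+m _ (width (list vtx) B ⊔ width nat d))))
    (≤-trans (count (eval (member (wk⁴ v) #0) (B ∷ d ∷ (B , d) ∷ x ∷ γ)) d)
      (+-mono-≤ (m≤n⊔m (width (list vtx) B) _) (m≤n+m 1 (⟦ size (verts I) ⊗ (size (verts I) ⊕ con 1) ⟧ₚ N))))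
  where
  count : ∀ {n} (ys d : List ⊤) →
    width {n} nat (caseList ys (tt ∷ d) (λ _ _ → d)) ≤ width {n} nat d + 1
  count []      d = ≤-reflexive (+-comm 1 _)
  count (_ ∷ _) d = m≤m+n _ 1

opaque
  dist : Input Γ → Prog Γ vtx → Prog Γ vtx → Prog Γ nat
  dist I u v = split (balls I u v) #1

-- A ball grows at the far end of a walk, whereas `Star` adds edges at the near end.
unsnoc : {V : Set} {G : Graph V} {u y x : V} → Adj G u y → (w : Walk G y x) →
  ∃ λ z → Adj G z x × Σ (Walk G u z) λ w′ → length w′ ≡ length w
unsnoc         e ε        = _ , e , ε , refl
unsnoc {G = G} e (e′ ◅ w) =
  let z , a , w′ , eq = unsnoc {G = G} e′ w in z , a , e ◅ w′ , cong suc eq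

module _ {G : Graph (Fin n)} (I : Input Γ) (u v : Prog Γ vtx) {γ : Vals n Γ} (R : Reads G I γ) where
  private
    a b : Fin n
    a = eval u γ
    b = eval v γ

    ball : List (Fin n) → List (Fin n) × List ⊤
    ball = iterate (verts I) (pair (cons u nil) nil) (distStep I v) γ

    -- The cases of `realised` say that the counter is still running, or that it has stopped at the
    -- length of an actual walk.
    record Invariant (k : ℕ) (B : List (Fin n)) (d : List ⊤) : Set where
      field
        ball⇔    : ∀ x → x ∈ₗ B ⇔ Σ (Walk G a x) λ w → length w ≤ k
        d≤k      : List.length d ≤ k
        minimal  : (w : Walk G a b) → List.length d ≤ length w
        realised : List.length d ≡ k ⊎ Σ (Walk G a b) λ w → length w ≡ List.length d

    open Invariant

    invariant : ∀ xs → Invariant (List.length xs) (proj₁ (ball xs)) (proj₂ (ball xs))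
    invariant [] = record
      { ball⇔    = λ x → mk⇔ (λ { (here refl) → ε , z≤n }) (λ { (ε , _) → here refl })
      ; d≤k      = z≤n
      ; minimal  = λ _ → z≤n
      ; realised = inj₁ refl
      }
    invariant (x ∷ xs) = record
      { ball⇔    = λ y → mk⇔ (larger y ∘ to (next∈ y)) (from (next∈ y) ∘ smaller y)
      ; d≤k      = proj₁ (counted (eval (member (wk⁴ v) #0) δ) refl)
      ; minimal  = proj₁ (proj₂ (counted (eval (member (wk⁴ v) #0) δ) refl))
      ; realised = proj₂ (proj₂ (counted (eval (member (wk⁴ v) #0) δ) refl))
      }
      where
      k = List.length xs
      B = proj₁ (ball xs)
      d = proj₂ (ball xs)
      inv = invariant xs
      δ : Vals n (list vtx ∷ nat ∷ (list vtx ×ₜ nat) ∷ vtx ∷ Γ)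
      δ = B ∷ d ∷ (B , d) ∷ x ∷ γ

      next∈ : ∀ y → _
      next∈ = next-spec (wkᵢ⁴ I) #0 {δ} (wkᴿ {x = B} (wkᴿ {x = d} (wkᴿ {x = B , d} (wkᴿ {x = x} R))))

      larger : ∀ y → (∃ λ z → z ∈ₗ B × (z ≡ y ⊎ Adj G z y)) → Σ (Walk G a y) λ w → length w ≤ suc k
      larger y (z , z∈ , h) with to (ball⇔ inv z) z∈
      larger y (z , z∈ , inj₁ refl) | w , w≤ = w , m≤n⇒m≤1+n w≤
      larger y (z , z∈ , inj₂ e)    | w , w≤ =
        w ◅◅ (e ◅ ε) , ≤-trans (≤-reflexive (trans (length-◅◅ {G = G} w _) (+-comm _ 1))) (s≤s w≤)

      smaller : ∀ y → (Σ (Walk G a y) λ w → length w ≤ suc k) → ∃ λ z → z ∈ₗ B × (z ≡ y ⊎ Adj G z y)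
      smaller y (ε , _)            = y , from (ball⇔ inv y) (ε , z≤n) , inj₁ refl
      smaller y (e ◅ w , s≤s w≤) =
        let z , e′ , w′ , eq = unsnoc {G = G} e w
        in z , from (ball⇔ inv z) (w′ , ≤-trans (≤-reflexive eq) w≤) , inj₂ e′

      counted : ∀ ys → eval (member (wk⁴ v) #0) δ ≡ ys →
        let d′ = caseList ys (tt ∷ d) (λ _ _ → d) in
        List.length d′ ≤ suc k × ((w : Walk G a b) → List.length d′ ≤ length w) ×
        (List.length d′ ≡ suc k ⊎ Σ (Walk G a b) λ w → length w ≡ List.length d′)
      counted [] eq =
        s≤s (d≤k inv) ,
        (λ w → ≤-trans (s≤s (d≤k inv)) (far w)) ,
        inj₁ (cong suc d≡k)
        where
        far : (w : Walk G a b) → suc k ≤ length w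
        far w = ≰⇒> λ w≤k → nonempty (from (member-spec (wk⁴ v) #0 δ) (from (ball⇔ inv b) (w , w≤k))) eq
        d≡k : List.length d ≡ k
        d≡k with realised inv
        ... | inj₁ d≡k      = d≡k
        -- A stopped counter would come with a walk of length at most `k`, against `far`.
        ... | inj₂ (w , w≡) = contradiction (≤-trans (far w) (≤-trans (≤-reflexive w≡) (d≤k inv))) 1+n≰n
      counted (y ∷ ys) eq =
        m≤n⇒m≤1+n (d≤k inv) , minimal inv , inj₂ close
        where
        close : Σ (Walk G a b) λ w → length w ≡ List.length d
        close with realised inv | to (ball⇔ inv b)
          (to (member-spec (wk⁴ v) #0 δ) (y , subst (y ∈ₗ_) (sym eq) (here refl)))
        ... | inj₂ found | _      = found
        ... | inj₁ d≡k   | w , w≤ = w , ≤-antisym (≤-trans w≤ (≤-reflexive (sym d≡k))) (minimal inv w)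

    -- The vertex list acts as a clock of `n` rounds. A counter that ran through all of them would
    -- exceed the length of some path, which is below `n`.
    ball-count : Connected G → let d = List.length (proj₂ (ball (eval (verts I) γ))) in
      (Σ (Walk G a b) λ w → length w ≡ d) × ((w : Walk G a b) → d ≤ length w)
    ball-count connected = walk′ (realised inv) , minimal inv
      where
      vs  = eval (verts I) γ
      inv = invariant vs
      walk′ : List.length (proj₂ (ball vs)) ≡ List.length vs ⊎ _ →
        Σ (Walk G a b) λ w → length w ≡ List.length (proj₂ (ball vs))
      walk′ (inj₂ found) = found
      walk′ (inj₁ d≡n)   = contradiction
        (≤-trans (path-length< (connected a b)) (≤-reflexive (sym
          (trans d≡n (trans (cong List.length (verts≡ R)) (length-tabulate id))))))
        (≤⇒≯ (minimal inv (walk (connected a b))))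

  opaque
    unfolding dist

    dist-spec : Connected G →
      (Σ (Walk G a b) λ w → length w ≡ List.length (eval (dist I u v) γ)) ×
      ((w : Walk G a b) → List.length (eval (dist I u v) γ) ≤ length w)
    dist-spec = ball-count

covered : Input Γ → (r : Prog Γ nat) (W : Prog Γ (list vtx)) (v : Prog Γ vtx) → Prog Γ nat
covered I r W v = first W (leq (dist (wkᵢ I) #0 (wk v)) (wk r))

passed : Input Γ → (s : Prog Γ vtx) (r : Prog Γ nat) (c₀ : Prog Γ vtx) (W₀ : Prog Γ (list vtx)) → Prog Γ nat
passed I s r c₀ W₀ = every (verts I)
  (implies (equal (append (dist (wkᵢ I) (wk s) #0) (wk r)) (dist (wkᵢ I) (wk s) (wk c₀)))
           (covered (wkᵢ I) (wk r) (wk W₀) #0))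

opaque
  edge : Input Γ → (s : Prog Γ vtx) (r : Prog Γ nat)
    (c : Prog Γ vtx) (W : Prog Γ (list vtx)) (c₀ : Prog Γ vtx) (W₀ : Prog Γ (list vtx)) → Prog Γ nat
  edge I s r c W c₀ W₀ =
    both (adjacent I c c₀)
      (both (equal (dist I s c) (cons star (dist I s c₀)))
        (both (every W (member #0 (wk (cons c W₀)))) (passed I s r c₀ W₀)))

  final : Input Γ → (s : Prog Γ vtx) (r : Prog Γ nat) (c : Prog Γ vtx) (W : Prog Γ (list vtx)) → Prog Γ nat
  final I s r c W = every (verts I)
    (implies (leq (dist (wkᵢ I) (wk s) (wk c)) (append (dist (wkᵢ I) (wk s) #0) (wk r)))
             (covered (wkᵢ I) (wk r) (wk W) #0))

-- Meaning of the tests made by the search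

module Correct {n} (G : Graph (Fin n)) (connected : Connected G) where
  private
    I₀ : Input (vtx ∷ vtx ∷ list vtx ∷ list (list nat) ∷ [])
    I₀ = record { verts = #2 ; rows = #3 }

    γ₀ : Fin n → Fin n → Vals n (vtx ∷ vtx ∷ list vtx ∷ list (list nat) ∷ [])
    γ₀ u v = u ∷ v ∷ allFin n ∷ adjacency G ∷ []

    spec₀ : ∀ u v → _
    spec₀ u v = dist-spec I₀ #0 #1 {γ₀ u v} (reads refl refl) connected

  -- The metric is the output of the program `dist` in one fixed scope; `dist≡` transfers it to
  -- every other scope.
  δ : Fin n → Fin n → ℕ
  δ u v = List.length (eval (dist I₀ #0 #1) (γ₀ u v))

  open Metric G δ (λ u v → proj₁ (spec₀ u v)) (λ {u} {v} w → proj₂ (spec₀ u v) w) public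

  module _ (I : Input Γ) {γ : Vals n Γ} (R : Reads G I γ) where

    dist≡ : ∀ u v → List.length (eval (dist I u v) γ) ≡ δ (eval u γ) (eval v γ)
    dist≡ u v =
      let (w , eq) , min = dist-spec I u v R connected
          (w₀ , eq₀) , min₀ = spec₀ (eval u γ) (eval v γ)
      in ≤-antisym (≤-trans (min w₀) (≤-reflexive eq₀)) (≤-trans (min₀ w) (≤-reflexive eq))

    dist+≡ : ∀ u v r →
      List.length (eval (append (dist I u v) r) γ) ≡ δ (eval u γ) (eval v γ) + List.length (eval r γ)
    dist+≡ u v r = trans (cong List.length (append-spec (dist I u v) r γ))
      (trans (length-++ (eval (dist I u v) γ)) (cong (_+ _) (dist≡ u v)))

    every-vertex : (q : Prog (vtx ∷ Γ) nat) {P : Fin n → Set} →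
      (∀ v → Holds (eval q (v ∷ γ)) ⇔ P v) → Holds (eval (every (verts I) q) γ) ⇔ (∀ v → P v)
    every-vertex q q⇔ = mk⇔
      (λ h v → to (q⇔ v) (to (every-spec (verts I) q γ) h v (v ∈ⱽ R)))
      (λ h → from (every-spec (verts I) q γ) λ v _ → from (q⇔ v) (h v))

  covered-spec : (I : Input Γ) {γ : Vals n Γ} (R : Reads G I γ) → ∀ r W v →
    Holds (eval (covered I r W v) γ) ⇔ Covered (eval W γ) (List.length (eval r γ)) (eval v γ)
  covered-spec I {γ} R r W v = mk⇔
    (λ h → let x , x∈ , h′ = to (first-spec W q γ) h
           in x , x∈ , subst (_≤ List.length (eval r γ)) (eq x) (to (leq-spec (dist (wkᵢ I) #0 (wk v)) (wk r) (x ∷ γ)) h′))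
    (λ (x , x∈ , le) → from (first-spec W q γ)
      (x , x∈ , from (leq-spec (dist (wkᵢ I) #0 (wk v)) (wk r) (x ∷ γ)) (subst (_≤ List.length (eval r γ)) (sym (eq x)) le)))
    where
    q = leq (dist (wkᵢ I) #0 (wk v)) (wk r)
    eq : ∀ x → _
    eq x = dist≡ (wkᵢ I) {x ∷ γ} (wkᴿ {x = x} R) #0 (wk v)

  Passed : Fin n → ℕ → Fin n → List (Fin n) → Set
  Passed s r c₀ W₀ = ∀ v → δ s v + r ≡ δ s c₀ → Covered W₀ r v

  passed-spec : (I : Input Γ) {γ : Vals n Γ} (R : Reads G I γ) → ∀ s r c₀ W₀ →
    Holds (eval (passed I s r c₀ W₀) γ) ⇔ Passed (eval s γ) (List.length (eval r γ)) (eval c₀ γ) (eval W₀ γ)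
  passed-spec I {γ} R s r c₀ W₀ = every-vertex I R (implies p q) λ v → mk⇔
    (λ h eq → to (covered-spec (wkᵢ I) (R′ v) (wk r) (wk W₀) #0)
      (to (implies-spec p q (v ∷ γ)) h (from (equal-spec a b (v ∷ γ)) (trans (eq₁ v) (trans eq (sym (eq₂ v)))))))
    (λ f → from (implies-spec p q (v ∷ γ)) λ h → from (covered-spec (wkᵢ I) (R′ v) (wk r) (wk W₀) #0)
      (f (trans (sym (eq₁ v)) (trans (to (equal-spec a b (v ∷ γ)) h) (eq₂ v)))))
    where
    a = append (dist (wkᵢ I) (wk s) #0) (wk r)
    b = dist (wkᵢ I) (wk s) (wk c₀)
    p = equal a b
    q = covered (wkᵢ I) (wk r) (wk W₀) #0
    R′ : ∀ (v : Fin n) → Reads G (wkᵢ I) (v ∷ γ)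
    R′ v = wkᴿ {σ = vtx} {x = v} R
    eq₁ : ∀ v → _
    eq₁ v = dist+≡ (wkᵢ I) {v ∷ γ} (R′ v) (wk s) #0 (wk r)
    eq₂ : ∀ v → _
    eq₂ v = dist≡ (wkᵢ I) {v ∷ γ} (R′ v) (wk s) (wk c₀)

  Final : Fin n → ℕ → Fin n → List (Fin n) → Set
  Final s r c W = ∀ v → δ s c ≤ δ s v + r → Covered W r v

  opaque
    unfolding final

    final-spec : ∀ {Γ} (I : Input Γ) {γ : Vals n Γ} (R : Reads G I γ) → ∀ s r c W →
      Holds (eval (final I s r c W) γ) ⇔ Final (eval s γ) (List.length (eval r γ)) (eval c γ) (eval W γ)
    final-spec {Γ} I {γ} R s r c W = every-vertex I R (implies p q) λ v → mk⇔
      (λ h le → to (covered-spec (wkᵢ I) (R′ v) (wk r) (wk W) #0)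
        (to (implies-spec p q (v ∷ γ)) h (from (leq-spec b a (v ∷ γ)) (subst₂ _≤_ (sym (eq₂ v)) (sym (eq₁ v)) le))))
      (λ f → from (implies-spec p q (v ∷ γ)) λ h → from (covered-spec (wkᵢ I) (R′ v) (wk r) (wk W) #0)
        (f (subst₂ _≤_ (eq₂ v) (eq₁ v) (to (leq-spec b a (v ∷ γ)) h))))
      where
      a b p q : Prog (vtx ∷ Γ) nat
      a = append (dist (wkᵢ I) (wk s) #0) (wk r)
      b = dist (wkᵢ I) (wk s) (wk c)
      p = leq b a
      q = covered (wkᵢ I) (wk r) (wk W) #0
      R′ : ∀ (v : Fin n) → Reads G (wkᵢ I) (v ∷ γ)
      R′ v = wkᴿ {σ = vtx} {x = v} R
      eq₁ : ∀ (v : Fin n) → List.length (eval a (v ∷ γ)) ≡ δ (eval s γ) v + List.length (eval r γ)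
      eq₁ v = dist+≡ (wkᵢ I) {v ∷ γ} (R′ v) (wk s) #0 (wk r)
      eq₂ : ∀ (v : Fin n) → List.length (eval b (v ∷ γ)) ≡ δ (eval s γ) (eval c γ)
      eq₂ v = dist≡ (wkᵢ I) {v ∷ γ} (R′ v) (wk s) (wk c)

  -- Here `c` is the new endpoint and `c₀` the one being left, so a stored path leads from its
  -- newest vertex back to `s`.
  Edge : Fin n → ℕ → Fin n → List (Fin n) → Fin n → List (Fin n) → Set
  Edge s r c W c₀ W₀ =
    Adj G c c₀ × δ s c ≡ suc (δ s c₀) × (∀ x → x ∈ₗ W → x ∈ₗ c ∷ W₀) × Passed s r c₀ W₀

  opaque
    unfolding edge

    edge-spec : ∀ {Γ} (I : Input Γ) {γ : Vals n Γ} (R : Reads G I γ) → ∀ s r c W c₀ W₀ →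
      Holds (eval (edge I s r c W c₀ W₀) γ) ⇔
      Edge (eval s γ) (List.length (eval r γ)) (eval c γ) (eval W γ) (eval c₀ γ) (eval W₀ γ)
    edge-spec {Γ} I {γ} R s r c W c₀ W₀ = mk⇔
      (λ h → let h₁ , h′  = to (both-spec p₁ (both p₂ (both p₃ p₄)) γ) h
                 h₂ , h″  = to (both-spec p₂ (both p₃ p₄) γ) h′
                 h₃ , h₄  = to (both-spec p₃ p₄ γ) h″
             in to (adjacent-spec I R c c₀) h₁ ,
                trans (sym (dist≡ I R s c)) (trans (to (equal-spec (dist I s c) (cons star (dist I s c₀)) γ) h₂) (cong suc (dist≡ I R s c₀))) ,
                (λ x x∈ → to (member-spec #0 (wk (cons c W₀)) (x ∷ γ)) (to (every-spec W (member #0 (wk (cons c W₀))) γ) h₃ x x∈)) ,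
                to (passed-spec I R s r c₀ W₀) h₄)
      (λ (h₁ , h₂ , h₃ , h₄) → from (both-spec p₁ (both p₂ (both p₃ p₄)) γ)
        ( from (adjacent-spec I R c c₀) h₁
        , from (both-spec p₂ (both p₃ p₄) γ)
          ( from (equal-spec (dist I s c) (cons star (dist I s c₀)) γ)
              (trans (dist≡ I R s c) (trans h₂ (cong suc (sym (dist≡ I R s c₀)))))
          , from (both-spec p₃ p₄ γ)
            ( from (every-spec W (member #0 (wk (cons c W₀))) γ)
                (λ x x∈ → from (member-spec #0 (wk (cons c W₀)) (x ∷ γ)) (h₃ x x∈))
            , from (passed-spec I R s r c₀ W₀) h₄))))
      where
      p₁ p₂ p₃ p₄ : Prog Γ nat
      p₁ = adjacent I c c₀
      p₂ = equal (dist I s c) (cons star (dist I s c₀))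
      p₃ = every W (member #0 (wk (cons c W₀)))
      p₄ = passed I s r c₀ W₀

-- A reached state (c , W), stored as a path from c to s together with W.
entry : Ty
entry = list vtx ×ₜ list vtx

module _ (I : Input Γ) (s : Prog Γ vtx) (r : Prog Γ nat) where

  -- The scope is that of `candidate` after two matches: head and tail of the stored path, the path,
  -- its list `W₀`, and the entry itself.
  candidateEdge : (c : Prog Γ vtx) (W : Prog Γ (list vtx)) → Prog (vtx ∷ list vtx ∷ list vtx ∷ list vtx ∷ entry ∷ Γ) nat
  candidateEdge c W = edge (wkᵢ² (wkᵢ³ I)) (wk⁵ s) (wk⁵ r) (wk⁵ c) (wk⁵ W) #0 #3

  opaque
    candidate : (c : Prog Γ vtx) (W : Prog Γ (list vtx)) → Prog (entry ∷ Γ) (list entry)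
    candidate c W = split #0 (case #0 nil
      (case (candidateEdge c W) nil
        (cons (pair (cons (wk² (wk⁵ c)) #4) (wk² (wk⁵ W))) nil)))

    candidate-∈ : ∀ c W (γ : Vals n Γ) path W₀ {e} →
      e ∈ₗ eval (candidate c W) ((path , W₀) ∷ γ) →
      ∃ λ c₀ → ∃ λ tl → path ≡ c₀ ∷ tl × e ≡ (eval c γ ∷ path , eval W γ) ×
        Holds (eval (candidateEdge c W) (c₀ ∷ tl ∷ path ∷ W₀ ∷ (path , W₀) ∷ γ))
    candidate-∈ c W γ (c₀ ∷ tl) W₀ e∈ =
      let eq , h = go (eval (candidateEdge c W) (c₀ ∷ tl ∷ (c₀ ∷ tl) ∷ W₀ ∷ (c₀ ∷ tl , W₀) ∷ γ)) e∈ in c₀ , tl , refl , eq , h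
      where
      go : ∀ (ys : List ⊤) {A : Set} {e′ e : A} → e ∈ₗ caseList ys [] (λ _ _ → e′ ∷ []) → e ≡ e′ × Holds ys
      go (y ∷ _) (here refl) = refl , y , here refl

    candidate-new : ∀ c W (γ : Vals n Γ) c₀ tl W₀ → let path = c₀ ∷ tl in
      Holds (eval (candidateEdge c W) (c₀ ∷ tl ∷ path ∷ W₀ ∷ (path , W₀) ∷ γ)) →
      Holds (eval (candidate c W) ((path , W₀) ∷ γ))
    candidate-new c W γ c₀ tl W₀ h = go (eval (candidateEdge c W) (c₀ ∷ tl ∷ (c₀ ∷ tl) ∷ W₀ ∷ (c₀ ∷ tl , W₀) ∷ γ)) h
      where
      go : ∀ (ys : List ⊤) {A : Set} {e′ : A} → Holds ys → Holds (caseList ys [] (λ _ _ → e′ ∷ []))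
      go (_ ∷ _) _ = _ , here refl
      go [] (_ , ())

-- Enumeration of tuples and of reachable states

foldr-base : {A B : Set} {f : A → List B → List B} → (∀ x a {y} → y ∈ₗ a → y ∈ₗ f x a) →
  ∀ xs {b y} → y ∈ₗ b → y ∈ₗ foldr f b xs
foldr-base mono []       y∈ = y∈
foldr-base mono (x ∷ xs) y∈ = mono x _ (foldr-base mono xs y∈)

foldr-new : {A B : Set} {f : A → List B → List B} {P : B → Set} → (∀ x a {y} → y ∈ₗ a → y ∈ₗ f x a) →
  ∀ xs {b x} → x ∈ₗ xs → (∀ a → ∃ λ y → P y × y ∈ₗ f x a) → ∃ λ y → P y × y ∈ₗ foldr f b xs
foldr-new mono (x ∷ xs) (here refl) new = new _
foldr-new mono (x ∷ xs) (there x∈)  new =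
  let y , Py , y∈ = foldr-new mono xs x∈ new in y , Py , mono x _ y∈

module _ (I : Input Γ) (Ws : Prog Γ (list (list vtx))) where

  prependAll : Prog Γ (list (list vtx))
  prependAll = foldGrow (verts I) nil (collect (wk² Ws) #0 (cons (cons #2 #0) nil))
    (con 1 ⊕ (X ⊕ size Ws) ⊕ size Ws ⊗ con 1)
    λ {_} {N} γ c a b →
      let S   = ⟦ size Ws ⟧ₚ N
          Ws≤ = sized Ws γ λ σ i → b σ (there i)
          c≤  = b _ (here refl)
      in ≤-trans (collect-width (wk² Ws) #0 (cons (cons #2 #0) nil) (a ∷ c ∷ γ)
           {K = S} {M = width (list (list vtx)) a + suc (N + S)}
           (λ { W W≤ (here refl) → ≤-trans
             (⊔-lub (≤-trans c≤ (≤-trans (m≤m+n N S) (n≤1+n _))) (s≤s (≤-trans W≤ (m≤n+m S N))))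
             (m≤n+m _ (width (list (list vtx)) a)) })
           (m≤m+n _ _) Ws≤)
         (≤-reflexive (+-assoc (width (list (list vtx)) a) _ _))

  prependAll-∈ : {G : Graph (Fin n)} {γ : Vals n Γ} → Reads G I γ → ∀ c {W} →
    W ∈ₗ eval Ws γ → c ∷ W ∈ₗ eval prependAll γ
  prependAll-∈ {γ = γ} R c {W} W∈ =
    let _ , eq , y∈ = foldr-new {P = _≡ c ∷ W}
          (λ x a → collect-base (wk² Ws) #0 (cons (cons #2 #0) nil) (a ∷ x ∷ γ))
          (eval (verts I) γ) (c ∈ⱽ R)
          (λ a → let _ , y∈ , y∈′ = collect-new (wk² Ws) #0 (cons (cons #2 #0) nil) (a ∷ c ∷ γ) W∈ (_ , here refl)
                 in _ , only y∈ , y∈′)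
    in subst (_∈ₗ eval prependAll γ) eq y∈
    where
    only : {A : Set} {x y : A} → x ∈ₗ y ∷ [] → x ≡ y
    only (here eq) = eq

-- The number `k` is fixed when the program is built, so the nesting of loops is fixed too, and only
-- the degree of the polynomial bounds depends on it.
tuples : Input Γ → ℕ → Prog Γ (list (list vtx))
tuples I zero    = cons nil nil
tuples I (suc k) = prependAll I (tuples I k)

tuples-∈ : {G : Graph (Fin n)} (I : Input Γ) {γ : Vals n Γ} → Reads G I γ → ∀ W →
  W ∈ₗ eval (tuples I (List.length W)) γ
tuples-∈ I R []      = here refl
tuples-∈ I R (c ∷ W) = prependAll-∈ I (tuples I (List.length W)) R c (tuples-∈ I R W)

module _ (I : Input Γ) (s : Prog Γ vtx) (r : Prog Γ nat) (Ws : Prog Γ (list (list vtx))) (T : Prog Γ (list entry)) where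

  -- One predecessor per state (`c` , `W`) suffices, as `Edge` looks only at states and never at the
  -- rest of a stored path. A round thus adds at most one entry per state, not one per path.
  successor : Prog (list vtx ∷ list entry ∷ vtx ∷ Γ) (list entry)
  successor = first (wk³ T) (candidate (wkᵢ³ I) (wk³ s) (wk³ r) #2 #0)

  extendTo : Prog (list entry ∷ vtx ∷ Γ) (list entry)
  extendTo = collect (wk² Ws) #0 successor

  -- New paths extend paths of `T`, not of the accumulator, so the same `M` bounds every new entry
  -- of the round.
  extendTo-width : ∀ (γ : Vals n Γ) {K S M} →
    width (list (list vtx)) (eval Ws γ) ≤ S →
    suc (width (list entry) (eval T γ) + (K + S)) ≤ M →
    ∀ c a → toℕ c ≤ K → width (list entry) a ≤ M → width (list entry) (eval extendTo (a ∷ c ∷ γ)) ≤ M + S * 1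
  extendTo-width γ {K} {S} {M} Ws≤ B≤M c a c≤K a≤ =
    collect-width (wk² Ws) #0 successor (a ∷ c ∷ γ) new≤ a≤ Ws≤
    where
    new≤ : ∀ W {e} → width (list vtx) W ≤ S → e ∈ₗ eval successor (W ∷ a ∷ c ∷ γ) → width entry e ≤ M
    new≤ W W≤ e∈ with first-∈ (wk³ T) (candidate (wkᵢ³ I) (wk³ s) (wk³ r) #2 #0) (W ∷ a ∷ c ∷ γ) e∈
    ... | (path , W₀) , e₀∈ , e∈′
      with candidate-∈ (wkᵢ³ I) (wk³ s) (wk³ r) #2 #0 (W ∷ a ∷ c ∷ γ) path W₀ e∈′
    ... | _ , _ , _ , refl , _ = ≤-trans
      (⊔-lub
        (⊔-lub (≤-trans c≤K (≤-trans (m≤m+n K S) KS≤))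
          (s≤s (≤-trans (≤-trans (m≤m⊔n _ (width (list vtx) W₀)) (∈-width entry e₀∈)) (m≤m+n _ (K + S)))))
        (≤-trans W≤ (≤-trans (m≤n+m S K) KS≤)))
      B≤M
      where
      KS≤ : K + S ≤ suc (width (list entry) (eval T γ) + (K + S))
      KS≤ = ≤-trans (m≤n+m _ (width (list entry) (eval T γ))) (n≤1+n _)

  extensions : Vals n Γ → List (Fin n) → List (⟦ entry ⟧ n)
  extensions = iterate (verts I) T extendTo

  -- The width of `T` enters with coefficient one. Any larger factor would be compounded by the
  -- rounds of `table`.
  extensions-width : ∀ (γ : Vals n Γ) {K S} →
    width (list (list vtx)) (eval Ws γ) ≤ S →
    ∀ cs → width (list vtx) cs ≤ K → width (list entry) (extensions γ cs) ≤
      suc (width (list entry) (eval T γ) + (K + S)) + K * (S * 1)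
  extensions-width γ {K} {S} Ws≤ = foldr-growth-above vtx (list entry) {b = eval T γ}
    (λ c a c≤K B≤M a≤ → extendTo-width γ Ws≤ B≤M c a c≤K a≤)
    (≤-trans (m≤m+n _ (K + S)) (n≤1+n _))

  extend : Prog Γ (list entry)
  extend = fold (verts I) T extendTo
    (con 1 ⊕ (size T ⊕ (X ⊕ size Ws)) ⊕ X ⊗ (size Ws ⊗ con 1))
    λ {_} {N} γ cs b cs≤ → ≤-trans (extensions-width γ (sized Ws γ b) cs cs≤)
      (s≤s (+-monoˡ-≤ (N * (⟦ size Ws ⟧ₚ N * 1)) (+-monoˡ-≤ (N + ⟦ size Ws ⟧ₚ N) (sized T γ b))))

module _ (I : Input Γ) (s : Prog Γ vtx) (r : Prog Γ nat) (Ws : Prog Γ (list (list vtx))) where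

  tableStep : Prog (list entry ∷ vtx ∷ Γ) (list entry)
  tableStep = extend (wkᵢ² I) (wk² s) (wk² r) (wk² Ws) #0

  -- The list `s ∷ []` can replace the window at level 0, all of whose entries are the source.
  table₀ : Prog Γ (list entry)
  table₀ = cons (pair (cons s nil) (cons s nil)) nil

  -- The vertices again act as a clock: a round can follow a shortest path by one more edge, and
  -- such a path has fewer than `n` edges.
  table : Prog Γ (list entry)
  table = foldGrow (verts I) table₀ tableStep
    (con 1 ⊕ (size (verts I) ⊕ size Ws) ⊕ size (verts I) ⊗ (size Ws ⊗ con 1))
    λ {_} {N} γ x a b →
      let b′ = λ σ i → b σ (there i) in
      ≤-trans (extensions-width (wkᵢ² I) (wk² s) (wk² r) (wk² Ws) #0 (a ∷ x ∷ γ)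
          (sized Ws γ b′) (eval (verts I) γ) (sized (verts I) γ b′))
        (≤-reflexive (rearrange (width (list entry) a) (⟦ size (verts I) ⟧ₚ N + ⟦ size Ws ⟧ₚ N) _))
    where
    rearrange : ∀ t k z → suc (t + k) + z ≡ t + (1 + k + z)
    rearrange t k z = trans (cong suc (+-assoc t k z)) (sym (+-suc t (k + z)))

  answer : Prog (entry ∷ Γ) (list vtx)
  answer = split #0 (case #0 nil (case (final (wkᵢ² (wkᵢ³ I)) (wk⁵ s) (wk⁵ r) #0 #3) nil #4))

  search : Prog Γ (list vtx)
  search = first table answer

-- Correctness of the search

module Solve {n} (G : Graph (Fin n)) (connected : Connected G) where
  open Correct G connected

  module _ (I : Input Γ) (s : Prog Γ vtx) (r : Prog Γ nat) (Ws : Prog Γ (list (list vtx)))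
    (T : Prog Γ (list entry)) {γ : Vals n Γ} (R : Reads G I γ) where
    private
      s′ = eval s γ
      r′ = List.length (eval r γ)

      mono : ∀ c a {e} → e ∈ₗ a → e ∈ₗ eval (extendTo I s r Ws T) (a ∷ c ∷ γ)
      mono c a = collect-base (wk² Ws) #0 (successor I s r Ws T) (a ∷ c ∷ γ)

      cand : Prog (entry ∷ list vtx ∷ list entry ∷ vtx ∷ Γ) (list entry)
      cand = candidate (wkᵢ³ I) (wk³ s) (wk³ r) #2 #0

      scope : Fin n → List (⟦ entry ⟧ n) → (W path W₀ : List (Fin n)) → Fin n → List (Fin n) →
        Vals n (vtx ∷ list vtx ∷ list vtx ∷ list vtx ∷ entry ∷ list vtx ∷ list entry ∷ vtx ∷ Γ)
      scope c a W path W₀ c₀ tl = c₀ ∷ tl ∷ path ∷ W₀ ∷ (path , W₀) ∷ W ∷ a ∷ c ∷ γ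

      candEdge : ∀ c a W path W₀ c₀ tl →
        Holds (eval (candidateEdge (wkᵢ³ I) (wk³ s) (wk³ r) #2 #0) (scope c a W path W₀ c₀ tl)) ⇔ Edge s′ r′ c W c₀ W₀
      candEdge c a W path W₀ c₀ tl =
        edge-spec (wkᵢ² (wkᵢ³ (wkᵢ³ I))) {scope c a W path W₀ c₀ tl}
          (reads (verts≡ R) (rows≡ R)) (wk⁵ (wk³ s)) (wk⁵ (wk³ r)) (wk⁵ #2) (wk⁵ #0) #0 #3

    extend-base : ∀ {e} → e ∈ₗ eval T γ → e ∈ₗ eval (extend I s r Ws T) γ
    extend-base = foldr-base mono (eval (verts I) γ)

    -- The search may pick a different predecessor, so of the new entry only the endpoint and the
    -- list are known. Completeness follows states alone and asks for no more.
    extend-new : ∀ {c W c₀ tl W₀} → (c₀ ∷ tl , W₀) ∈ₗ eval T γ → Edge s′ r′ c W c₀ W₀ →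
      W ∈ₗ eval Ws γ → ∃ λ path → (c ∷ path , W) ∈ₗ eval (extend I s r Ws T) γ
    extend-new {c} {W} {c₀} {tl} {W₀} e₀∈ edge′ W∈ =
      let _ , (path , eq) , e∈ = foldr-new {P = λ e → ∃ λ path → e ≡ (c ∷ path , W)}
            mono (eval (verts I) γ) (c ∈ⱽ R) new
      in path , subst (_∈ₗ eval (extend I s r Ws T) γ) eq e∈
      where
      new : (a : List (⟦ entry ⟧ n)) → ∃ λ e → (∃ λ path → e ≡ (c ∷ path , W)) × e ∈ₗ eval (extendTo I s r Ws T) (a ∷ c ∷ γ)
      new a =
        let e , e∈ , e∈′ = collect-new (wk² Ws) #0 (successor I s r Ws T) (a ∷ c ∷ γ) W∈
              (from (first-spec (wk³ T) cand (W ∷ a ∷ c ∷ γ))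
                (_ , e₀∈ , candidate-new (wkᵢ³ I) (wk³ s) (wk³ r) #2 #0 (W ∷ a ∷ c ∷ γ) c₀ tl W₀
                  (from (candEdge c a W (c₀ ∷ tl) W₀ c₀ tl) edge′)))
            (path , W₁) , _ , e∈″ = first-∈ (wk³ T) cand (W ∷ a ∷ c ∷ γ) e∈
            _ , _ , _ , eq , _ = candidate-∈ (wkᵢ³ I) (wk³ s) (wk³ r) #2 #0 (W ∷ a ∷ c ∷ γ) path W₁ e∈″
        in e , (path , eq) , e∈′

    extend-∈ : ∀ {e} → e ∈ₗ eval (extend I s r Ws T) γ →
      e ∈ₗ eval T γ ⊎ ∃ λ c → ∃ λ W → ∃ λ c₀ → ∃ λ tl → ∃ λ W₀ →
        (c₀ ∷ tl , W₀) ∈ₗ eval T γ × Edge s′ r′ c W c₀ W₀ × e ≡ (c ∷ c₀ ∷ tl , W)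
    extend-∈ = go (eval (verts I) γ)
      where
      go : ∀ cs {e} → e ∈ₗ extensions I s r Ws T γ cs →
        e ∈ₗ eval T γ ⊎ ∃ λ c → ∃ λ W → ∃ λ c₀ → ∃ λ tl → ∃ λ W₀ →
          (c₀ ∷ tl , W₀) ∈ₗ eval T γ × Edge s′ r′ c W c₀ W₀ × e ≡ (c ∷ c₀ ∷ tl , W)
      go []       e∈ = inj₁ e∈
      go (c ∷ cs) e∈ with extensions I s r Ws T γ cs | go cs
      ... | a | rec with collect-∈ (wk² Ws) #0 (successor I s r Ws T) (a ∷ c ∷ γ) e∈
      ... | inj₂ e∈a = rec e∈a
      ... | inj₁ (W , _ , e∈′) with first-∈ (wk³ T) cand (W ∷ a ∷ c ∷ γ) e∈′
      ... | (path , W₀) , e₀∈ , e∈″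
        with candidate-∈ (wkᵢ³ I) (wk³ s) (wk³ r) #2 #0 (W ∷ a ∷ c ∷ γ) path W₀ e∈″
      ... | c₀ , tl , refl , eq , h =
        inj₂ (c , W , c₀ , tl , W₀ , e₀∈ , to (candEdge c a W path W₀ c₀ tl) h , eq)

  Sound : Fin n → ℕ → ⟦ entry ⟧ n → Set
  Sound s r (path , W) = ∃ λ c → Σ (Walk G c s) λ w →
    vertices w ≡ path × length w ≡ δ s c × (∀ x → x ∈ₗ W → x ∈ₗ path) ×
    (∀ v → δ s v + r < δ s c → Covered path r v)

  -- The level rises by one, so the vertices that newly satisfy `δ s v + r < δ s c` are those with
  -- equality at `c₀`, which `Passed` has tested. Earlier coverage persists because the path only
  -- gains vertices.
  sound-edge : ∀ {s r c W c₀ tl W₀} → Sound s r (c₀ ∷ tl , W₀) → Edge s r c W c₀ W₀ →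
    Sound s r (c ∷ c₀ ∷ tl , W)
  sound-edge {s} {r} {c} {W} {c₀} {tl} {W₀} (c₁ , w , vertices≡ , w≡ , W₀⊆ , old) (adj , level , W⊆ , pass)
    with head-vertices {G = G} w vertices≡
  ... | refl = c , adj ◅ w , cong (c ∷_) vertices≡ , trans (cong suc w≡) (sym level) ,
    (λ x x∈ → include (W⊆ x x∈)) , λ v lt → cover v (m<1+n⇒m<n∨m≡n (subst (δ s v + r <_) level lt))
    where
    include : ∀ {x} → x ∈ₗ c ∷ W₀ → x ∈ₗ c ∷ c₀ ∷ tl
    include (here eq)  = here eq
    include (there x∈) = there (W₀⊆ _ x∈)
    cover : ∀ v → δ s v + r < δ s c₀ ⊎ δ s v + r ≡ δ s c₀ → Covered (c ∷ c₀ ∷ tl) r v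
    cover v (inj₁ lt) = let x , x∈ , le = old v lt in x , there x∈ , le
    cover v (inj₂ eq) = let x , x∈ , le = pass v eq in x , there (W₀⊆ x x∈) , le

  Within : ShortestPath G → ℕ → Set
  Within P r = ∀ v → ∃ λ d → DistTo G v (pathVertices P) d × d ≤ r

  -- The invariant handles the vertices with `δ s v + r < δ s c`, and `Final` all others.
  sound-final : ∀ {s r c tl W} → Sound s r (c ∷ tl , W) → Final s r c W →
    Σ (ShortestPath G) λ P → pathVertices P ≡ c ∷ tl × Within P r
  sound-final {s} {r} {c} {tl} {W} (c₁ , w , vertices≡ , w≡ , W⊆ , old) fin
    with head-vertices {G = G} w vertices≡
  ... | refl with shortestPath w (trans w≡ (δ-sym s c))
  ... | p , refl = record
    { path = p ; shortest = subst (Dist G c s) (sym (trans w≡ (δ-sym s c))) (dist-δ c s) } ,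
    vertices≡ , λ v → distTo (vertices w) (subst (λ xs → Covered xs r v) (sym vertices≡) (cover v))
    where
    cover : ∀ v → Covered (c ∷ tl) r v
    cover v with δ s c ≤? δ s v + r
    ... | yes le = let x , x∈ , le′ = fin v le in x , W⊆ x x∈ , le′
    ... | no ¬le = old v (≰⇒> ¬le)

  module _ (I : Input Γ) (s : Prog Γ vtx) (r : Prog Γ nat) (Ws : Prog Γ (list (list vtx)))
    {γ : Vals n Γ} (R : Reads G I γ) where
    private
      s′ = eval s γ
      r′ = List.length (eval r γ)

      tables : List (Fin n) → List (⟦ entry ⟧ n)
      tables = iterate (verts I) (table₀ I s r Ws) (tableStep I s r Ws) γ

      R² : (a : List (⟦ entry ⟧ n)) (x : Fin n) → Reads G (wkᵢ² {σ₁ = list entry} {vtx} I) (a ∷ x ∷ γ)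
      R² a x = reads (verts≡ R) (rows≡ R)

    tables-sound : ∀ xs {e} → e ∈ₗ tables xs → Sound s′ r′ e
    tables-sound [] (here refl) = s′ , ε , refl , sym (δ-refl s′) , (λ _ x∈ → x∈) ,
      λ v lt → contradiction (subst (δ s′ v + r′ <_) (δ-refl s′) lt) λ ()
    tables-sound (x ∷ xs) e∈
      with extend-∈ (wkᵢ² I) (wk² s) (wk² r) (wk² Ws) #0 (R² (tables xs) x) e∈
    ... | inj₁ e∈′ = tables-sound xs e∈′
    ... | inj₂ (c , W , c₀ , tl , W₀ , e₀∈ , edge′ , refl) = sound-edge (tables-sound xs e₀∈) edge′

    answer-spec : ∀ path W → Holds (eval (answer I s r Ws) ((path , W) ∷ γ)) →
      ∃ λ c → ∃ λ tl → path ≡ c ∷ tl × Final s′ r′ c W × eval (answer I s r Ws) ((path , W) ∷ γ) ≡ path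
    answer-spec []       W (_ , ())
    answer-spec (c ∷ tl) W h =
      let f , eq = go (eval fin δ′) h
      in c , tl , refl , to (final-spec (wkᵢ² (wkᵢ³ I)) {δ′} (reads (verts≡ R) (rows≡ R)) (wk⁵ s) (wk⁵ r) #0 #3) f , eq
      where
      δ′ : Vals n (vtx ∷ list vtx ∷ list vtx ∷ list vtx ∷ entry ∷ Γ)
      δ′ = c ∷ tl ∷ (c ∷ tl) ∷ W ∷ (c ∷ tl , W) ∷ γ
      fin = final (wkᵢ² (wkᵢ³ I)) (wk⁵ s) (wk⁵ r) #0 #3
      go : ∀ (ys : List ⊤) {A : Set} {zs : List A} → Holds (caseList ys [] λ _ _ → zs) →
        Holds ys × caseList ys [] (λ _ _ → zs) ≡ zs
      go (y ∷ _) h = (y , here refl) , refl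
      go [] (_ , ())

    answer-holds : ∀ c tl W → Final s′ r′ c W → Holds (eval (answer I s r Ws) ((c ∷ tl , W) ∷ γ))
    answer-holds c tl W f =
      go (eval (final (wkᵢ² (wkᵢ³ I)) (wk⁵ s) (wk⁵ r) #0 #3) δ′)
        (from (final-spec (wkᵢ² (wkᵢ³ I)) {δ′} (reads (verts≡ R) (rows≡ R)) (wk⁵ s) (wk⁵ r) #0 #3) f)
      where
      δ′ : Vals n (vtx ∷ list vtx ∷ list vtx ∷ list vtx ∷ entry ∷ Γ)
      δ′ = c ∷ tl ∷ (c ∷ tl) ∷ W ∷ (c ∷ tl , W) ∷ γ
      go : ∀ (ys : List ⊤) → Holds ys → Holds (caseList ys [] λ _ _ → c ∷ tl)
      go (_ ∷ _) _ = _ , here refl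
      go [] (_ , ())

    search-sound : Holds (eval (search I s r Ws) γ) →
      Σ (ShortestPath G) λ P → pathVertices P ≡ eval (search I s r Ws) γ × Within P r′
    search-sound h with first-≡ (table I s r Ws) (answer I s r Ws) γ h
    ... | (path , W) , e∈ , eq with answer-spec path W (subst Holds eq h)
    ... | c , tl , refl , f , eq′ =
      let P , P≡ , within = sound-final (tables-sound (eval (verts I) γ) e∈) f
      in P , trans P≡ (sym (trans eq eq′)) , within

    module _ {b} (w : Walk G s′ b) (w-shortest : length w ≡ δ s′ b) (ℓ q : ℕ) .{{_ : NonZero q}}
      (covers : ∀ v → Covered (vertices w) ℓ v)
      (r≡ : r′ ≡ ℓ + ℓ ÷ q) (Ws∋ : ∀ W → List.length W ≡ 2 + 2 * q → W ∈ₗ eval Ws γ) where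
      open Landmarks w w-shortest ℓ q covers using (p; L; window; level; window-zero; window-suc; window-length; window-covers)

      covered-⊇ : ∀ {xs ys v} → (∀ x → x ∈ₗ xs → x ∈ₗ ys) → Covered xs r′ v → Covered ys r′ v
      covered-⊇ xs⊆ (x , x∈ , le) = x , xs⊆ x x∈ , le

      -- The states along `w` are reached, although the stored path may be another one. Containing
      -- `window t` is asked for instead of equality because of the short initial list.
      reached : ∀ xs t → t ≤ List.length xs → t ≤ L →
        ∃ λ path → ∃ λ W → (p t ∷ path , W) ∈ₗ tables xs × (∀ x → x ∈ₗ window t → x ∈ₗ W)
      reached [] zero _ _ = [] , s′ ∷ [] ,
        subst (λ x → (x ∷ [] , s′ ∷ []) ∈ₗ tables []) (sym (at-zero {G = G} w)) (here refl) ,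
        λ x x∈ → here (window-zero x∈)
      reached (y ∷ xs) zero _ _ =
        let path , W , e∈ , W⊇ = reached xs zero z≤n z≤n
        in path , W , extend-base (wkᵢ² I) (wk² s) (wk² r) (wk² Ws) #0 (R² (tables xs) y) e∈ , W⊇
      reached (y ∷ xs) (suc t) (s≤s t≤) t<L =
        let path , W , e∈ , W⊇ = reached xs t t≤ (<⇒≤ t<L)
            path′ , e∈′ = extend-new (wkᵢ² I) (wk² s) (wk² r) (wk² Ws) #0 (R² (tables xs) y) e∈
              ( Graph.sym G (at-adjacent {G = G} w t<L)
              , trans (level t<L) (cong suc (sym (level (<⇒≤ t<L))))
              , (λ x x∈ → include W⊇ (window-suc t x∈))
              , λ v eq → let eq′ = trans eq (level (<⇒≤ t<L)) in covered-⊇ W⊇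
                  (subst (λ r → Covered (window t) r v) (sym r≡)
                    (window-covers (<⇒≤ t<L) (≤-reflexive (sym (trans (cong (δ s′ v +_) (sym r≡)) eq′)))
                      (inj₂ (trans (cong (δ s′ v +_) (sym r≡)) eq′)))) )
              (Ws∋ (window (suc t)) (window-length (suc t)))
        in path′ , window (suc t) , e∈′ , λ _ x∈ → x∈
        where
        include : ∀ {W x} → (∀ x → x ∈ₗ window t → x ∈ₗ W) → x ∈ₗ p (suc t) ∷ window t → x ∈ₗ p (suc t) ∷ W
        include W⊇ (here eq)  = here eq
        include W⊇ (there x∈) = there (W⊇ _ x∈)

      search-complete : Holds (eval (search I s r Ws) γ)
      search-complete =
        let path , W , e∈ , W⊇ = reached (eval (verts I) γ) L L≤ ≤-refl
        in from (first-spec (table I s r Ws) (answer I s r Ws) γ)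
          (_ , e∈ , answer-holds (p L) path W λ v le → covered-⊇ W⊇
            (subst (λ r → Covered (window L) r v) (sym r≡)
              (window-covers ≤-refl (subst₂ _≤_ (level ≤-refl) (cong (δ s′ v +_) r≡) le) (inj₁ refl))))
        where
        L≤ : L ≤ List.length (eval (verts I) γ)
        L≤ = begin
          length w                           ≡⟨ w-shortest ⟩
          δ s′ b                             ≤⟨ proj₂ (dist-δ s′ b) _ (connected s′ b , refl) ⟩
          length (walk (connected s′ b))     ≤⟨ <⇒≤ (path-length< (connected s′ b)) ⟩
          n                                  ≡⟨ length-tabulate id ⟨
          List.length (allFin n)             ≡⟨ cong List.length (verts≡ R) ⟨
          List.length (eval (verts I) γ)     ∎
          where open ≤-Reasoning

-- Time and correctness of the whole program

^-distribʳ-* : ∀ k m n → (m * n) ^ k ≡ m ^ k * n ^ k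
^-distribʳ-* zero    m n = refl
^-distribʳ-* (suc k) m n = trans (cong (m * n *_) (^-distribʳ-* k m n))
  ([m*n]*[o*p]≡[m*o]*[n*p] m n (m ^ k) (n ^ k))

-- The base is `suc N` because it is positive: exponents may then be raised to a common value, also
-- at `N = 0`.
poly-bounded : ∀ p → ∃ λ c → ∃ λ b → ∀ N → ⟦ p ⟧ₚ N ≤ c * suc N ^ b
poly-bounded (con k) = k , 0 , λ N → ≤-reflexive (sym (*-identityʳ k))
poly-bounded X       = 1 , 1 , λ N → ≤-trans (n≤1+n N)
  (≤-reflexive (sym (trans (*-identityˡ _) (*-identityʳ (suc N)))))
poly-bounded (p ⊕ q) =
  let c , b , p≤ = poly-bounded p
      d , e , q≤ = poly-bounded q
  in c + d , b + e , λ N → begin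
    ⟦ p ⟧ₚ N + ⟦ q ⟧ₚ N                              ≤⟨ +-mono-≤ (p≤ N) (q≤ N) ⟩
    c * suc N ^ b + d * suc N ^ e                    ≤⟨ +-mono-≤ (*-monoʳ-≤ c (^-monoʳ-≤ (suc N) (m≤m+n b e)))
                                                                 (*-monoʳ-≤ d (^-monoʳ-≤ (suc N) (m≤n+m e b))) ⟩
    c * suc N ^ (b + e) + d * suc N ^ (b + e)        ≡⟨ *-distribʳ-+ (suc N ^ (b + e)) c d ⟨
    (c + d) * suc N ^ (b + e)                        ∎
  where open ≤-Reasoning
poly-bounded (p ⊗ q) =
  let c , b , p≤ = poly-bounded p
      d , e , q≤ = poly-bounded q
  in c * d , b + e , λ N → begin
    ⟦ p ⟧ₚ N * ⟦ q ⟧ₚ N                              ≤⟨ *-mono-≤ (p≤ N) (q≤ N) ⟩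
    (c * suc N ^ b) * (d * suc N ^ e)                ≡⟨ [m*n]*[o*p]≡[m*o]*[n*p] c (suc N ^ b) d (suc N ^ e) ⟩
    (c * d) * (suc N ^ b * suc N ^ e)                ≡⟨ cong (c * d *_) (^-distribˡ-+-* (suc N) b e) ⟨
    c * d * suc N ^ (b + e)                          ∎
  where open ≤-Reasoning
poly-bounded (p ⟨ q ⟩) =
  let c , b , p≤ = poly-bounded p
      d , e , q≤ = poly-bounded q
  in c * suc d ^ b , e * b , λ N → begin
    ⟦ p ⟧ₚ (⟦ q ⟧ₚ N)                                ≤⟨ p≤ _ ⟩
    -- One summand `suc N ^ e` of `suc d * suc N ^ e` absorbs the successor.
    c * suc (⟦ q ⟧ₚ N) ^ b                           ≤⟨ *-monoʳ-≤ c (^-monoˡ-≤ b (+-mono-≤ (m^n>0 (suc N) e) (q≤ N))) ⟩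
    c * (suc d * suc N ^ e) ^ b                      ≡⟨ cong (c *_) (^-distribʳ-* b (suc d) (suc N ^ e)) ⟩
    c * (suc d ^ b * (suc N ^ e) ^ b)                ≡⟨ *-assoc c (suc d ^ b) _ ⟨
    c * suc d ^ b * (suc N ^ e) ^ b                  ≡⟨ cong (c * suc d ^ b *_) (^-*-assoc (suc N) e b) ⟩
    c * suc d ^ b * suc N ^ (e * b)                  ∎
  where open ≤-Reasoning

list-width : ∀ σ (xs : List (⟦ σ ⟧ n)) {B} → (∀ {x} → x ∈ₗ xs → width σ x ≤ B) →
  width (list σ) xs ≤ B + List.length xs
list-width σ []       _   = z≤n
list-width σ (x ∷ xs) {B} xs≤ = ⊔-lub (≤-trans (xs≤ (here refl)) (m≤m+n B _))
  (≤-trans (s≤s (list-width σ xs (xs≤ ∘ there))) (≤-reflexive (sym (+-suc B _))))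

allFin-width : ∀ n → width (list vtx) (allFin n) ≤ n + n
allFin-width n = ≤-trans (list-width vtx (allFin n) (λ {v} _ → <⇒≤ (toℕ<n v)))
  (≤-reflexive (cong (λ k → n + k) (length-tabulate id)))

adjacency-width : (G : Graph (Fin n)) → width {n} (list (list nat)) (adjacency G) ≤ 1 + n + n
adjacency-width {n} G = ≤-trans (list-width (list nat) (adjacency G) (row≤ ∘ proj₂ ∘ proj₂ ∘ ∈-map⁻ _))
  (≤-reflexive (cong (λ k → 1 + n + k) (trans (length-map _ (allFin n)) (length-tabulate id))))
  where
  bit≤ : ∀ b → width {n} nat (bit b) ≤ 1
  bit≤ false = z≤n
  bit≤ true  = ≤-refl
  row≤ : ∀ {u row} → row ≡ map (λ v → bit (adj? G u v)) (allFin n) → width {n} (list nat) row ≤ 1 + n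
  row≤ {u} refl = ≤-trans
    (list-width nat (map (λ v → bit (adj? G u v)) (allFin n)) λ x∈ →
      let v , _ , eq = ∈-map⁻ (λ v → bit (adj? G u v)) x∈
      in subst (λ x → width {n} nat x ≤ 1) (sym eq) (bit≤ (adj? G u v)))
    (≤-reflexive (cong suc (trans (length-map _ (allFin n)) (length-tabulate id))))

encodeList-map : {A B : Set} (f : B → Value) (g : A → B) (h : A → Value) → (∀ x → f (g x) ≡ h x) →
  ∀ xs → encodeList f (map g xs) ≡ encodeList h xs
encodeList-map f g h eq []       = refl
encodeList-map f g h eq (x ∷ xs) = cong₂ node (eq x) (encodeList-map f g h eq xs)

enc-adjacency : (G : Graph (Fin n)) → enc {n} (list (list nat)) (adjacency G) ≡ encodeGraph G
enc-adjacency {n} G = encodeList-map _ _ _ (λ u → encodeList-map _ _ _ (λ v → enc-bit (adj? G u v)) (allFin n)) (allFin n)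
  where
  enc-bit : ∀ b → enc {n} nat (bit b) ≡ encodeBool b
  enc-bit false = refl
  enc-bit true  = refl

-- The vertex list is obtained by numbering the rows of the matrix; `enc-vertices` then reinterprets
-- the unary numbers as vertices.
listVertices : Prog (list (list nat) ∷ []) (list nat)
listVertices = numbers #0

radiusInput : Input (nat ∷ list vtx ∷ list (list nat) ∷ [])
radiusInput .verts = #1
radiusInput .rows  = #2

sourceInput : Input (vtx ∷ nat ∷ list vtx ∷ list (list nat) ∷ [])
sourceInput = wkᵢ radiusInput

-- Radii below `n + n` are enough: for `ℓ` at most `n - 1`, the target `ℓ + ℓ ÷ q` is at most twice
-- `n - 1`.
radii : Prog (list vtx ∷ list (list nat) ∷ []) (list nat)
radii = numbers (append #0 #0)

position : Renaming (list vtx ∷ list (list nat) ∷ []) 4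
position _ (here _)  = zero
position _ (there _) = suc zero

module _ (q : ℕ) where

  windows : Prog (vtx ∷ nat ∷ list vtx ∷ list (list nat) ∷ []) (list (list vtx))
  windows = tuples sourceInput (2 + 2 * q)

  solveFrom : Prog (vtx ∷ nat ∷ list vtx ∷ list (list nat) ∷ []) (list vtx)
  solveFrom = search sourceInput #0 #1 windows

  solveRadius : Prog (nat ∷ list vtx ∷ list (list nat) ∷ []) (list vtx)
  solveRadius = first #1 solveFrom

  opaque
    minimise : Prog (list vtx ∷ list (list nat) ∷ []) (list vtx)
    minimise = first radii solveRadius

    program : Term 3
    program = bind (code listVertices λ _ _ → zero) (code minimise position)

    programTime : Poly
    programTime = con 1 ⊕ (time listVertices ⊕ time minimise)

γ₁ : (G : Graph (Fin n)) → Vals n (list (list nat) ∷ [])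
γ₁ G = adjacency G ∷ []

γ₂ : (G : Graph (Fin n)) → Vals n (list vtx ∷ list (list nat) ∷ [])
γ₂ {n} G = allFin n ∷ adjacency G ∷ []

enc-vertices : (G : Graph (Fin n)) → enc {n} (list nat) (eval listVertices (γ₁ G)) ≡ enc (list vtx) (allFin n)
enc-vertices {n} G = trans (cong (enc {n} (list nat)) (trans (numbers-spec #0 (γ₁ G))
    (cong (λ k → map (unary ∘ toℕ) (allFin k)) (trans (length-map _ (allFin n)) (length-tabulate id)))))
  (encodeList-map _ _ _ (λ v → encode-unary (toℕ v)) (allFin n))

opaque
  unfolding program programTime

  program-runs : ∀ q (G : Graph (Fin n)) S ℓ → input G S ℓ ⊢ program q ⇓ enc (list vtx) (eval (minimise q) (γ₂ G)) within ⟦ programTime q ⟧ₚ (1 + n + n)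
  program-runs {n} q G S ℓ =
    let t₁ , d₁ , c₁ = runs listVertices (γ₁ G) (λ _ _ → zero) (input G S ℓ) b₁ ρ₁
        _ , d₂ , c₂ = runs (minimise q) (γ₂ G) position (enc (list vtx) (allFin n) ∷ input G S ℓ) b₂ ρ₂
    in _ , bind (subst (λ v → input G S ℓ ⊢ code listVertices (λ _ _ → zero) ⇓ v [ t₁ ]) (enc-vertices G) d₁) d₂ ,
       s≤s (+-mono-≤ c₁ c₂)
    where
    b₁ : Bounded (1 + n + n) (γ₁ G)
    b₁ _ (here refl) = adjacency-width G
    ρ₁ : Represents (input G S ℓ) (λ _ _ → zero) (γ₁ G)
    ρ₁ _ (here refl) = sym (enc-adjacency G)
    b₂ : Bounded (1 + n + n) (γ₂ G)
    b₂ = ≤-trans (allFin-width n) (n≤1+n _) ∷ᵇ b₁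
    ρ₂ : Represents (enc (list vtx) (allFin n) ∷ input G S ℓ) position (γ₂ G)
    ρ₂ _ (here refl)         = refl
    ρ₂ _ (there (here refl)) = sym (enc-adjacency G)

module _ {n} (G : Graph (Fin n)) (connected : Connected G) where
  open Correct G connected
  open Solve G connected

  opaque
    unfolding minimise

    minimise-correct : (P* : ShortestPath G) (ℓ q : ℕ) .{{_ : NonZero q}} → Within P* ℓ →
      Σ (ShortestPath G) λ P → pathVertices P ≡ eval (minimise q) (γ₂ G) × Within P (ℓ + ℓ ÷ q)
    minimise-correct P* ℓ q within =
      let j , j≤i , eq , h = first-least radii (solveRadius q) (γ₂ G) (λ j → unary (toℕ j)) radii≡ {i} holds
          s , s∈ , eq′ = first-≡ #1 (solveFrom q) (unary (toℕ j) ∷ γ₂ G) h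
          P , P≡ , within′ = search-sound sourceInput #0 #1 (windows q) {s ∷ unary (toℕ j) ∷ γ₂ G} (reads refl refl)
            (subst Holds eq′ h)
      in P , trans P≡ (sym (trans eq eq′)) , λ v →
         let d , D , d≤ = within′ v
         in d , D , ≤-trans d≤ (≤-trans (≤-reflexive (length-replicate (toℕ j))) (≤-trans j≤i
              (≤-trans (≤-reflexive (toℕ-fromℕ< r<)) (+-mono-≤ (m⊓n≤m ℓ (pred n)) (/-monoˡ-≤ q (m⊓n≤m ℓ (pred n)))))))
      where
      open ShortestPath P* using (source; target; path; shortest)
      -- All distances are below n, so ℓ may be capped.
      ℓ′ k : ℕ
      ℓ′ = ℓ ⊓ pred n
      k = List.length (eval (append #0 #0) (γ₂ G))

      k≡ : k ≡ n + n
      k≡ = trans (cong List.length (append-spec #0 #0 (γ₂ G)))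
        (trans (length-++ (allFin n)) (cong₂ (λ a b → a + b) (length-tabulate {n = n} id) (length-tabulate {n = n} id)))

      δ<n : ∀ u v → δ u v < n
      δ<n u v = ≤-trans (s≤s (proj₂ (dist-δ u v) _ (connected u v , refl))) (path-length< (connected u v))

      r< : ℓ′ + ℓ′ ÷ q < k
      r< = begin-strict
        ℓ′ + ℓ′ ÷ q          ≤⟨ +-mono-≤ (m⊓n≤n ℓ (pred n)) (≤-trans (m/n≤m ℓ′ q) (m⊓n≤n ℓ (pred n))) ⟩
        pred n + pred n      <⟨ +-mono-<-≤ (pred< n source) pred[n]≤n ⟩
        n + n                ≡⟨ k≡ ⟨
        k                    ∎
        where
        open ≤-Reasoning
        pred< : ∀ n → Fin n → pred n < n
        pred< (suc n) _ = ≤-refl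

      i : Fin k
      i = fromℕ< r<

      radii≡ : eval radii (γ₂ G) ≡ tabulate {n = k} (λ j → unary (toℕ j))
      radii≡ = trans (numbers-spec (append #0 #0) (γ₂ G)) (map-tabulate {n = k} id (λ j → unary (toℕ j)))

      covers : ∀ v → Covered (vertices (walk path)) ℓ′ v
      covers v =
        let d , D , d≤ = within v
            (x , _ , Dx) , _ = D
        in covered-distTo D (⊓-glb d≤ (<⇒≤pred (subst (_< n) (sym (dist≡δ Dx)) (δ<n v x))))

      holds : Holds (eval (solveRadius q) (unary (toℕ i) ∷ γ₂ G))
      holds = from (first-spec #1 (solveFrom q) (unary (toℕ i) ∷ γ₂ G))
        (source , ∈-allFin source ,
         search-complete sourceInput #0 #1 (windows q) {source ∷ unary (toℕ i) ∷ γ₂ G} (reads refl refl)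
           (walk path) (dist≡δ shortest) ℓ′ q covers
           (trans (length-replicate (toℕ i)) (toℕ-fromℕ< r<))
           λ W length≡ → subst (λ m → W ∈ₗ eval (tuples sourceInput m) (source ∷ unary (toℕ i) ∷ γ₂ G)) length≡
             (tuples-∈ {G = G} sourceInput {source ∷ unary (toℕ i) ∷ γ₂ G} (reads refl refl) W))

-- Rational bounds and the theorem

integer-≤ : ∀ {i j} → i / 1 ≤ℚ j / 1 → i ℤ.≤ j
integer-≤ {i} {j} i≤j with
  ℚᵘ.≤-respʳ-≃ (ℚ.toℚᵘ-fromℚᵘ (mkℚᵘ j 0)) (ℚᵘ.≤-respˡ-≃ (ℚ.toℚᵘ-fromℚᵘ (mkℚᵘ i 0)) (ℚ.toℚᵘ-mono-≤ i≤j))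
... | *≤* le = subst₂ ℤ._≤_ (ℤ.*-identityʳ i) (ℤ.*-identityʳ j) le

-- The numerator of `η` is at least 1, so `η` is at least 1 / q. Multiplied by `q`, the claim
-- becomes the inequality `bound` between natural numbers.
scaled-≤ : ∀ η {a q-1} → toℚᵘ η ≡ mkℚᵘ (ℤ.+ suc a) q-1 → ∀ {ℓ d} → d ≤ ℓ + ℓ ÷ suc q-1 →
  ℤ.+ d / 1 ≤ℚ (1ℚ +ℚ η) *ℚ (ℤ.+ ℓ / 1)
scaled-≤ η {a} {q-1} η≡ {ℓ} {d} d≤ = ℚ.toℚᵘ-cancel-≤
  (ℚᵘ.≤-respˡ-≃ (ℚᵘ.≃-sym (ℚ.toℚᵘ-fromℚᵘ (mkℚᵘ (ℤ.+ d) 0)))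
    (ℚᵘ.≤-respʳ-≃ (ℚᵘ.≃-sym rhs) (*≤* (subst₂ ℤ._≤_ lhs≡ rhs≡ (ℤ.+≤+ bound)))))
  where
  q = suc q-1
  rhs : toℚᵘ ((1ℚ +ℚ η) *ℚ (ℤ.+ ℓ / 1)) ℚᵘ.≃ (mkℚᵘ (ℤ.+ 1) 0 ℚᵘ.+ mkℚᵘ (ℤ.+ suc a) q-1) ℚᵘ.* mkℚᵘ (ℤ.+ ℓ) 0
  rhs = ℚᵘ.≃-trans (ℚ.toℚᵘ-homo-* (1ℚ +ℚ η) (ℤ.+ ℓ / 1))
    (ℚᵘ.*-cong (subst (λ e → toℚᵘ (1ℚ +ℚ η) ℚᵘ.≃ mkℚᵘ (ℤ.+ 1) 0 ℚᵘ.+ e) η≡ (ℚ.toℚᵘ-homo-+ 1ℚ η)) (ℚ.toℚᵘ-fromℚᵘ (mkℚᵘ (ℤ.+ ℓ) 0)))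
  bound : d * q ≤ (q + suc a) * ℓ
  bound = begin
    d * q                      ≤⟨ *-monoˡ-≤ q d≤ ⟩
    (ℓ + ℓ ÷ q) * q            ≡⟨ *-distribʳ-+ q ℓ (ℓ ÷ q) ⟩
    ℓ * q + ℓ ÷ q * q          ≤⟨ +-mono-≤ (≤-reflexive (*-comm ℓ q)) (m/n*n≤m ℓ q) ⟩
    q * ℓ + ℓ                  ≤⟨ +-monoʳ-≤ (q * ℓ) (m≤m+n ℓ (a * ℓ)) ⟩
    q * ℓ + suc a * ℓ          ≡⟨ *-distribʳ-+ ℓ q (suc a) ⟨
    (q + suc a) * ℓ            ∎
    where open ≤-Reasoning
  r = (mkℚᵘ (ℤ.+ 1) 0 ℚᵘ.+ mkℚᵘ (ℤ.+ suc a) q-1) ℚᵘ.* mkℚᵘ (ℤ.+ ℓ) 0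
  lhs≡ : ℤ.+ (d * q) ≡ ℤ.+ d ℤ.* ℚᵘ.↧ r
  lhs≡ = trans (ℤ.pos-* d q) (cong (λ k → ℤ.+ d ℤ.* ℤ.+ k) (sym (trans (*-identityʳ (1 * q)) (*-identityˡ q))))
  rhs≡ : ℤ.+ ((q + suc a) * ℓ) ≡ ℚᵘ.↥ r ℤ.* ℚᵘ.↧ mkℚᵘ (ℤ.+ d) 0
  rhs≡ = trans (ℤ.pos-* (q + suc a) ℓ) (sym (trans (ℤ.*-identityʳ (ℚᵘ.↥ r))
    (cong₂ (λ i j → (i ℤ.+ j) ℤ.* ℤ.+ ℓ) (ℤ.*-identityˡ (ℤ.+ q)) (ℤ.*-identityʳ (ℤ.+ suc a)))))

theorem2 : (ε : ℚ) → 0ℚ <ℚ ε →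
    Σ (Term 3) λ program → ∃ λ (a : ℕ) → ∃ λ (b : ℕ) → ∃ λ (c : ℕ) →
    (n k : ℕ) (G : Graph (Fin n)) (S : Subset n) (ℓ : ℤ) →
    Connected G →
    ∣ S ∣ ≡ k →
    Forest (G -ᵍ S) →
    (Σ (ShortestPath G) λ P* → EccentricityAtMost G P* (ℓ / 1)) →
    Σ (ShortestPath G) λ P → ∃ λ (time : ℕ) →
    input G S ℓ ⊢ program ⇓ encodePath P [ time ]
    × EccentricityAtMost G P ((1ℚ +ℚ ε) *ℚ (ℓ / 1))
    × time ≤ c * (2 ^ (a * (k * ⌈log₂ k ⌉)) * n ^ b)
theorem2 (mkℚ (ℤ.+ zero) _ _) (ℚ.*<* (ℤ.+<+ ()))
theorem2 (mkℚ -[1+ _ ]   _ _) (ℚ.*<* ())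
theorem2 η@(mkℚ (ℤ.+ suc a) q-1 _) _ =
  let c , b , time≤ = poly-bounded (programTime q)
  -- For fixed `q` the time is polynomial in `n`, hence the witness 0 for the coefficient in the
  -- exponent of 2. The factor `4 ^ b` comes from `2 + n + n ≤ 4 * n`, valid because the source of
  -- `P*` shows that `n` is positive.
  in program q , 0 , b , c * 4 ^ b , λ n k G S ℓ connected _ _ (P* , ecc) →
    let m , ℓ≡ , within = natural G P* {ℓ} ecc
        P , P≡ , within′ = minimise-correct G connected P* m q within
        t , run , t≤ = program-runs q G S ℓ
        open ≤-Reasoning
    in P , t , subst (λ xs → input G S ℓ ⊢ program q ⇓ enc (list vtx) xs [ t ]) (sym P≡) run ,
       (λ v → let d , D , d≤ = within′ v
              in d , D , subst (λ ℓ → ℤ.+ d / 1 ≤ℚ (1ℚ +ℚ η) *ℚ (ℓ / 1)) (sym ℓ≡) (scaled-≤ η {a} {q-1} refl {m} d≤)) ,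
       (begin
          t                                      ≤⟨ t≤ ⟩
          ⟦ programTime q ⟧ₚ (1 + n + n)         ≤⟨ time≤ (1 + n + n) ⟩
          c * (2 + n + n) ^ b                    ≤⟨ *-monoʳ-≤ c (^-monoˡ-≤ b (input≤ n (ShortestPath.source P*))) ⟩
          c * (4 * n) ^ b                        ≡⟨ cong (c *_) (^-distribʳ-* b 4 n) ⟩
          c * (4 ^ b * n ^ b)                    ≡⟨ *-assoc c (4 ^ b) (n ^ b) ⟨
          c * 4 ^ b * n ^ b                      ≡⟨ cong (c * 4 ^ b *_) (*-identityˡ (n ^ b)) ⟨
          c * 4 ^ b * (1 * n ^ b)                ∎)
  where
  q : ℕ
  q = suc q-1

  -- A negative `ℓ` would lie below the distance from the source of `P*` to `P*`.
  natural : ∀ {n} (G : Graph (Fin n)) (P* : ShortestPath G) {ℓ} → EccentricityAtMost G P* (ℓ / 1) →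
    ∃ λ m → ℓ ≡ ℤ.+ m × (∀ v → ∃ λ d → DistTo G v (pathVertices P*) d × d ≤ m)
  natural G P* {ℤ.+ m}      ecc = m , refl , λ v → let d , D , d≤ = ecc v in d , D , ℤ.drop‿+≤+ (integer-≤ d≤)
  natural G P* { -[1+ m ]} ecc with ecc (ShortestPath.source P*)
  ... | d , _ , d≤ with integer-≤ {ℤ.+ d} { -[1+ m ]} d≤
  ... | ()

  input≤ : ∀ n → Fin n → 2 + n + n ≤ 4 * n
  input≤ (suc n) _ = ≤-trans (+-monoˡ-≤ (suc n + suc n) (+-mono-≤ (s≤s (z≤n {n})) (s≤s (z≤n {n}))))
    (≤-reflexive (solve 1 (λ x → x :+ x :+ (x :+ x) := con 4 :* x) refl (suc n)))
    where
    open +-*-Solver
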